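{- Let $\ell\ge 2$ and let $k_1,\dots,k_\ell$ be positive integers, all of the same parity, such that the value $1$ occurs at most once among them. Let $k^\ast=\frac12\min_{1\le i<j\le \ell}(k_i+k_j)$. Then $$\mathrm{ex}(n,\Theta_{k_1,\dots,k_\ell})=O\big(n^{1+\frac{1}{k^\ast}}\big)$$ as $n\to\infty$ (the implied constant may depend on $k_1,\dots,k_\ell$).
   Context: For a graph $H$, $\mathrm{ex}(n,H)$ denotes the maximum number of edges of a graph on $n$ vertices containing no subgraph isomorphic to $H$. The generalized theta graph $\Theta_{k_1,\dots,k_\ell}$ is the graph obtained by fixing two vertices $p,p'$ and joining them by $\ell$ internally vertex-disjoint paths of lengths (numbers of edges) $k_1,\dots,k_\ell$ respectively. Since all $k_i$ have the same parity, $k^\ast$ is an integer and the graph is bipartite. -}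

module Defs where

open import Data.Nat using (ℕ; zero; suc; _+_; _*_; _^_; _≤_; _<_; _<ᵇ_; _%_)
open import Data.Nat.Properties using (_<?_)
open import Data.Bool using (Bool; true; false; if_then_else_; _∧_)
open import Data.Fin using (Fin; toℕ)
open import Data.List using (List; map; allFin)
open import Data.Nat.ListAction using (sum)
open import Data.Product using (Σ; ∃; _×_; _,_)
open import Relation.Nullary using (¬_; yes; no)
open import Relation.Binary.PropositionalEquality using (_≡_)
open import Function.Definitions using (Injective)

record Graph (n : ℕ) : Set where
  field
    adj   : Fin n → Fin n → Bool
    sym   : ∀ u v → adj u v ≡ adj v u
    irref : ∀ v → adj v v ≡ false
open Graph public

edgeCount : ∀ {n} → Graph n → ℕ
edgeCount {n} G =
  sum (map (λ u → sum (map (λ v →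
    if (toℕ u <ᵇ toℕ v) ∧ adj G u v then 1 else 0) (allFin n))) (allFin n))

-- Vertices of the generalized theta graph Θ_{k_1,...,k_ℓ}:
-- the two poles p, p' and, on the i-th path (of length k i), the
-- internal vertices numbered m = 0 .. k i - 2 (i.e. suc m < k i).
data ThetaV (ℓ : ℕ) (k : Fin ℓ → ℕ) : Set where
  pole₁ : ThetaV ℓ k
  pole₂ : ThetaV ℓ k
  inner : (i : Fin ℓ) (m : ℕ) → suc m < k i → ThetaV ℓ k

-- The j-th vertex (j = 0 .. k i) along the i-th path from p to p'.
pathVertex : ∀ {ℓ} (k : Fin ℓ → ℕ) → Fin ℓ → ℕ → ThetaV ℓ k
pathVertex k i zero = pole₁
pathVertex k i (suc m) with suc m <? k i
... | yes p = inner i m p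
... | no _  = pole₂

ContainsTheta : ∀ {n} (ℓ : ℕ) (k : Fin ℓ → ℕ) → Graph n → Set
ContainsTheta {n} ℓ k G =
  Σ (ThetaV ℓ k → Fin n) λ f →
    Injective _≡_ _≡_ f ×
    (∀ (i : Fin ℓ) (j : ℕ) → j < k i →
       adj G (f (pathVertex k i j)) (f (pathVertex k i (suc j))) ≡ true)

-- s = k* = (1/2) min_{i ≠ j} (k_i + k_j), written without division:
-- 2s is attained by some pair i ≠ j and is ≤ k_i + k_j for all pairs i ≠ j.
IsKStar : ∀ {ℓ} (k : Fin ℓ → ℕ) → ℕ → Set
IsKStar {ℓ} k s =
  (Σ (Fin ℓ) λ i → Σ (Fin ℓ) λ j → ¬ i ≡ j × k i + k j ≡ 2 * s) ×
  (∀ i j → ¬ i ≡ j → 2 * s ≤ k i + k j)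

{-# OPTIONS --safe #-}
module Submission where

-- Weight a walk by the product of 1 / deg over all its vertices but the last, and call it good if
-- its weight is at least a constant fraction of the weight of all walks with the same length and
-- ends. If for every j ≤ s few walks of length j are bad with only good proper subwalks, then, by
-- stationarity of the random walk, most walks of length s are good paths through vertices of large
-- degree. Each pair of vertices is joined by boundedly many good walks, so there are O(n²) of them,
-- each of small weight, which bounds the number of edges.
--
-- Otherwise fix x and j such that a positive fraction of the j-walks from x are bad with good proper
-- subwalks. Discarding the bad walks whose prefix or end vertex is shared by too small a proportion
-- of bad walks, repeatedly, leaves a family in which a walk can be exchanged for another one with
-- the same prefix, or with the same end vertex, avoiding any bounded set of vertices. (For a fixed
-- end: only boundedly many of the walks pass through a given vertex, their two halves being good,
-- while each of them is bad and so has small weight.) From a vertex at distance i₀ from x on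
-- such a walk one moves on to its end, alternates between the last two layers, and finally returns
-- to x, on internally disjoint paths of lengths (j − i₀) + j + 2t for all bounded t. If the shortest path of
-- the theta graph has length a < j, then i₀ = a and the initial segment serves as that path: the
-- other lengths are at least 2s − a ≥ 2j − a. If a ≥ j, then i₀ ∈ {j − 1, j} is chosen by parity.

open import Defs hiding (sym; irref)
open import Data.Nat using (ℕ; zero; suc; _+_; _*_; _^_; _∸_; _⊔_; _≤_; _<_; _%_; _/_; z≤n; s≤s; s≤s⁻¹; _≤?_; _<?_; _<ᵇ_; NonZero; >-nonZero; ≢-nonZero⁻¹)
open import Data.Nat.Properties hiding (_≟_)
open import Data.Nat.Divisibility using (_∣_; quotient; m∣n⇒n≡quotient*m)
open import Data.Nat.ListAction using (sum; product)
open import Data.Nat.ListAction.Properties using (∈⇒∣product; product≢0)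
open import Data.Nat.Tactic.RingSolver using (solve-∀)
open import Data.Bool using (true; false; if_then_else_; _∧_)
open import Data.Fin using (Fin; toℕ; zero; suc)
open import Data.List using (List; []; _∷_; [_]; map; length; _++_; take; drop; allFin; upTo; reverse; cartesianProductWith)
open import Data.List.Properties using (length-++; ++-assoc; take++drop≡id; length-take; take-all; length-tabulate; length-upTo; length-reverse; unfold-reverse)
open import Data.List.Membership.Propositional using (_∈_; _∉_)
open import Data.List.Membership.Propositional.Properties using (∈-allFin; ∈-map⁺; ∈-upTo⁺; ∈-upTo⁻; ∈-++⁺ˡ; ∈-++⁺ʳ; ∈-cartesianProductWith⁻)
open import Data.List.Relation.Unary.Any using (here; there)
open import Data.List.Relation.Unary.All using (All; []; _∷_)
open import Data.List.Relation.Unary.AllPairs using ([]; _∷_)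
open import Data.List.Relation.Unary.Unique.Propositional using (Unique)
open import Data.List.Relation.Unary.Unique.Propositional.Properties using (allFin⁺; ++⁺; take⁺; drop⁺)
open import Data.Product using (Σ; ∃; _×_; _,_; proj₁; proj₂)
open import Data.Sum using (_⊎_; inj₁; inj₂)
open import Data.Unit using (⊤; tt)
open import Data.Empty using (⊥; ⊥-elim)
open import Function using (_∘_; id)
open import Relation.Nullary using (¬_; Dec; yes; no; contradiction)
open import Relation.Nullary.Decidable using (¬?; _×-dec_)
open import Relation.Unary using (Decidable)
open import Relation.Binary.PropositionalEquality using (_≡_; _≢_; refl; sym; trans; cong; cong₂; subst; subst₂; module ≡-Reasoning)
import Data.Fin.Properties as Finₚ
import Data.List.Relation.Unary.All as All
import Data.List.Relation.Unary.All.Properties as Allₚ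
import Data.Bool.Properties as Boolₚ
import Data.List.Membership.DecPropositional as DecMembership
open import Data.Nat.DivMod using (m≡m%n+[m/n]*n; m%n<n; m/n*n≤m; [m+kn]%n≡m%n)

-- Finite sums, indicators and lists.

∑ : {A : Set} → List A → (A → ℕ) → ℕ
∑ xs f = sum (map f xs)

# : {P : Set} → Dec P → ℕ
# (yes _) = 1
# (no _)  = 0

#≤1 : {P : Set} (d : Dec P) → # d ≤ 1
#≤1 (yes _) = ≤-refl
#≤1 (no _)  = z≤n

#-mono : {P Q : Set} (d : Dec P) (e : Dec Q) → (P → Q) → # d ≤ # e
#-mono (yes _) (yes _) f = ≤-refl
#-mono (yes p) (no q)  f = contradiction (f p) q
#-mono (no _)  _       f = z≤n

#-yes : {P : Set} (d : Dec P) → P → # d ≡ 1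
#-yes (yes _) p = refl
#-yes (no q)  p = contradiction p q

#-no : {P : Set} (d : Dec P) → ¬ P → # d ≡ 0
#-no (yes p) q = contradiction p q
#-no (no _)  q = refl

#-pos : {P : Set} (d : Dec P) → 0 < # d → P
#-pos (yes p) _ = p

module _ {A : Set} where

  ∑-mono : (xs : List A) {f g : A → ℕ} → (∀ {x} → x ∈ xs → f x ≤ g x) → ∑ xs f ≤ ∑ xs g
  ∑-mono []       h = z≤n
  ∑-mono (x ∷ xs) h = +-mono-≤ (h (here refl)) (∑-mono xs (h ∘ there))

  ∑-cong : (xs : List A) {f g : A → ℕ} → (∀ {x} → x ∈ xs → f x ≡ g x) → ∑ xs f ≡ ∑ xs g
  ∑-cong []       h = refl
  ∑-cong (x ∷ xs) h = cong₂ _+_ (h (here refl)) (∑-cong xs (h ∘ there))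

  ∑-+ : (xs : List A) (f g : A → ℕ) → ∑ xs (λ x → f x + g x) ≡ ∑ xs f + ∑ xs g
  ∑-+ []       f g = refl
  ∑-+ (x ∷ xs) f g rewrite ∑-+ xs f g = interchange (f x) (g x) (∑ xs f) (∑ xs g)
    where
    interchange : ∀ a b c d → a + b + (c + d) ≡ a + c + (b + d)
    interchange = solve-∀

  ∑-* : (c : ℕ) (xs : List A) (f : A → ℕ) → ∑ xs (λ x → c * f x) ≡ c * ∑ xs f
  ∑-* c []       f = sym (*-zeroʳ c)
  ∑-* c (x ∷ xs) f rewrite ∑-* c xs f = sym (*-distribˡ-+ c (f x) (∑ xs f))

  ∑-*ʳ : (c : ℕ) (xs : List A) (f : A → ℕ) → ∑ xs (λ x → f x * c) ≡ ∑ xs f * c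
  ∑-*ʳ c xs f = trans (∑-cong xs (λ {x} _ → *-comm (f x) c)) (trans (∑-* c xs f) (*-comm c _))

  ∑-const : (xs : List A) (c : ℕ) → ∑ xs (λ _ → c) ≡ length xs * c
  ∑-const []       c = refl
  ∑-const (x ∷ xs) c = cong (c +_) (∑-const xs c)

  ∑-zero : (xs : List A) {f : A → ℕ} → (∀ {x} → x ∈ xs → f x ≡ 0) → ∑ xs f ≡ 0
  ∑-zero xs h = trans (∑-cong xs h) (trans (∑-const xs 0) (*-zeroʳ (length xs)))

  ∑-++ : (xs ys : List A) (f : A → ℕ) → ∑ (xs ++ ys) f ≡ ∑ xs f + ∑ ys f
  ∑-++ []       ys f = refl
  ∑-++ (x ∷ xs) ys f = trans (cong (f x +_) (∑-++ xs ys f)) (sym (+-assoc (f x) _ _))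

  ∑-pos : (xs : List A) (f : A → ℕ) → 0 < ∑ xs f → ∃ λ x → x ∈ xs × 0 < f x
  ∑-pos (x ∷ xs) f p with f x in eq
  ... | suc m = x , here refl , subst (0 <_) (sym eq) (s≤s z≤n)
  ... | zero  = let (y , y∈ , q) = ∑-pos xs f p in y , there y∈ , q

  ∈⇒≤∑ : {xs : List A} (f : A → ℕ) {x : A} → x ∈ xs → f x ≤ ∑ xs f
  ∈⇒≤∑ f (here refl) = m≤m+n _ _
  ∈⇒≤∑ f (there p)   = ≤-trans (∈⇒≤∑ f p) (m≤n+m _ _)

∑-swap : {A B : Set} (xs : List A) (ys : List B) (f : A → B → ℕ) →
         ∑ xs (λ x → ∑ ys (f x)) ≡ ∑ ys (λ y → ∑ xs (λ x → f x y))
∑-swap []       ys f = sym (∑-zero ys (λ _ → refl))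
∑-swap (x ∷ xs) ys f =
  trans (cong (∑ ys (f x) +_) (∑-swap xs ys f)) (sym (∑-+ ys (f x) (λ y → ∑ xs (λ x → f x y))))

∑-map : {A B : Set} (h : A → B) (xs : List A) (f : B → ℕ) → ∑ (map h xs) f ≡ ∑ xs (f ∘ h)
∑-map h []       f = refl
∑-map h (x ∷ xs) f = cong (f (h x) +_) (∑-map h xs f)

∑-product : {A B C : Set} (h : A → B → C) (xs : List A) (ys : List B) (f : C → ℕ) →
            ∑ (cartesianProductWith h xs ys) f ≡ ∑ xs (λ x → ∑ ys (λ y → f (h x y)))
∑-product h []       ys f = refl
∑-product h (x ∷ xs) ys f =
  trans (∑-++ (map (h x) ys) _ f) (cong₂ _+_ (∑-map (h x) ys f) (∑-product h xs ys f))

^-distribʳ-* : ∀ a b k → (a * b) ^ k ≡ a ^ k * b ^ k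
^-distribʳ-* a b zero    = refl
^-distribʳ-* a b (suc k) rewrite ^-distribʳ-* a b k = interchange a b (a ^ k) (b ^ k)
  where
  interchange : ∀ a b c d → a * b * (c * d) ≡ a * c * (b * d)
  interchange = solve-∀

take-length-++ : {A : Set} (c d : List A) → take (length c) (c ++ d) ≡ c
take-length-++ []      d = refl
take-length-++ (v ∷ c) d = cong (v ∷_) (take-length-++ c d)

drop-length-++ : {A : Set} (c d : List A) → drop (length c) (c ++ d) ≡ d
drop-length-++ []      d = refl
drop-length-++ (v ∷ c) d = drop-length-++ c d

length-take-≤ : {A : Set} {i j : ℕ} {l : List A} → length l ≡ j → i ≤ j → length (take i l) ≡ i
length-take-≤ {i = i} {l = l} refl i≤j = trans (length-take i l) (m≤n⇒m⊓n≡m i≤j)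

length-take-++ : {A : Set} {i j : ℕ} (l : List A) {d : List A} →
  length l ≡ j → i ≤ j → length d ≡ j ∸ i → length (take i l ++ d) ≡ j
length-take-++ {i = i} l len i≤j d-len =
  trans (length-++ (take i l)) (trans (cong₂ _+_ (length-take-≤ len i≤j) d-len) (m+[n∸m]≡n i≤j))

-- Lists of vertices as candidate walks.

module _ {n : ℕ} where

  infix 4 _≟_
  _≟_ : (x y : Fin n) → Dec (x ≡ y)
  _≟_ = Finₚ._≟_

  infix 4 _∈?_
  _∈?_ : (x : Fin n) (xs : List (Fin n)) → Dec (x ∈ xs)
  _∈?_ = DecMembership._∈?_ _≟_

  ∑-≟-unique : {xs : List (Fin n)} → Unique xs → (e : Fin n) → ∑ xs (λ y → # (e ≟ y)) ≤ 1
  ∑-≟-unique []                      e = z≤n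
  ∑-≟-unique (_∷_ {x = x} {xs} x∉ u) e with e ≟ x
  ... | no _     = ∑-≟-unique u e
  ... | yes refl = ≤-reflexive (cong suc (∑-zero xs (λ y∈ → #-no (e ≟ _) (All.lookup x∉ y∈))))

  ∑-≟≤1 : (e : Fin n) → ∑ (allFin n) (λ y → # (e ≟ y)) ≤ 1
  ∑-≟≤1 = ∑-≟-unique (allFin⁺ n)

  ∑-fibres≤ : {A : Set} (xs : List A) (e : A → Fin n) (f : A → ℕ) →
              ∑ (allFin n) (λ y → ∑ xs (λ x → # (e x ≟ y) * f x)) ≤ ∑ xs f
  ∑-fibres≤ xs e f = begin
    ∑ (allFin n) (λ y → ∑ xs (λ x → # (e x ≟ y) * f x)) ≡⟨ ∑-swap (allFin n) xs (λ y x → # (e x ≟ y) * f x) ⟩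
    ∑ xs (λ x → ∑ (allFin n) (λ y → # (e x ≟ y) * f x)) ≤⟨ ∑-mono xs (λ {x} _ → begin
      ∑ (allFin n) (λ y → # (e x ≟ y) * f x)   ≡⟨ ∑-*ʳ (f x) (allFin n) (λ y → # (e x ≟ y)) ⟩
      ∑ (allFin n) (λ y → # (e x ≟ y)) * f x   ≤⟨ *-monoˡ-≤ (f x) (∑-≟≤1 (e x)) ⟩
      1 * f x                                  ≡⟨ *-identityˡ (f x) ⟩
      f x                                      ∎) ⟩
    ∑ xs f ∎
    where open ≤-Reasoning

  ≤∑-fibres : {A : Set} (xs : List A) (e : A → Fin n) (f : A → ℕ) →
              ∑ xs f ≤ ∑ (allFin n) (λ y → ∑ xs (λ x → # (e x ≟ y) * f x))
  ≤∑-fibres xs e f = begin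
    ∑ xs f ≤⟨ ∑-mono xs (λ {x} _ → begin
      f x                                     ≡⟨ sym (*-identityˡ (f x)) ⟩
      1 * f x                                 ≡⟨ cong (_* f x) (sym (#-yes (e x ≟ e x) refl)) ⟩
      # (e x ≟ e x) * f x                     ≤⟨ ∈⇒≤∑ (λ y → # (e x ≟ y) * f x) (∈-allFin (e x)) ⟩
      ∑ (allFin n) (λ y → # (e x ≟ y) * f x)  ∎) ⟩
    ∑ xs (λ x → ∑ (allFin n) (λ y → # (e x ≟ y) * f x)) ≡⟨ ∑-swap xs (allFin n) (λ x y → # (e x ≟ y) * f x) ⟩
    ∑ (allFin n) (λ y → ∑ xs (λ x → # (e x ≟ y) * f x)) ∎
    where open ≤-Reasoning

  ∑-allFin-const : ∀ c → ∑ (allFin n) (λ _ → c) ≡ n * c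
  ∑-allFin-const c = trans (∑-const (allFin n) c) (cong (_* c) (length-tabulate {n = n} id))

  -- A walk from `x` is stored as the list of its later vertices, the start being kept apart. Lists
  -- that do not follow edges are included; the weight `u` vanishes on them.
  words : ℕ → List (List (Fin n))
  words zero    = [ [] ]
  words (suc k) = cartesianProductWith _∷_ (allFin n) (words k)

  ∈-words : ∀ k {l} → l ∈ words k → length l ≡ k
  ∈-words zero    (here refl) = refl
  ∈-words (suc k) p with ∈-cartesianProductWith⁻ _∷_ (allFin n) (words k) p
  ... | _ , _ , _ , l∈ , refl = cong suc (∈-words k l∈)

  ∑-words-suc : ∀ k (g : List (Fin n) → ℕ) →
                ∑ (words (suc k)) g ≡ ∑ (allFin n) (λ v → ∑ (words k) (λ l → g (v ∷ l)))
  ∑-words-suc k g = ∑-product _∷_ (allFin n) (words k) g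

  ∑-words-+ : ∀ i k (g : List (Fin n) → ℕ) →
              ∑ (words (i + k)) g ≡ ∑ (words i) (λ c → ∑ (words k) (λ d → g (c ++ d)))
  ∑-words-+ zero    k g = sym (+-identityʳ _)
  ∑-words-+ (suc i) k g =
    trans (∑-words-suc (i + k) g)
    (trans (∑-cong (allFin n) (λ {v} _ → ∑-words-+ i k (λ l → g (v ∷ l))))
           (sym (∑-words-suc i (λ c → ∑ (words k) (λ d → g (c ++ d))))))

  end : Fin n → List (Fin n) → Fin n
  end x []      = x
  end x (v ∷ l) = end v l

  end-++ : ∀ x c d → end x (c ++ d) ≡ end (end x c) d
  end-++ x []      d = refl
  end-++ x (v ∷ c) d = end-++ v c d

-- The random walk, scaled to integers.

module Weights {n : ℕ} (G : Graph n) where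

  A : Fin n → Fin n → ℕ
  A v w = if adj G v w then 1 else 0

  A≤1 : ∀ v w → A v w ≤ 1
  A≤1 v w with adj G v w
  ... | true  = ≤-refl
  ... | false = z≤n

  A-sym : ∀ v w → A v w ≡ A w v
  A-sym v w = cong (λ b → if b then 1 else 0) (Graph.sym G v w)

  deg : Fin n → ℕ
  deg v = ∑ (allFin n) (A v)

  -- The random walk with step probabilities 1 / deg v is scaled to integers:
  -- q v = M / deg v, where M is a common multiple of the degrees.
  abstract
    M : ℕ
    M = product (map (λ v → 1 ⊔ deg v) (allFin n))

    private
      divides-M : ∀ v → (1 ⊔ deg v) ∣ M
      divides-M v = ∈⇒∣product (∈-map⁺ (λ v → 1 ⊔ deg v) (∈-allFin v))

    q : Fin n → ℕ
    q v = quotient (divides-M v)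

    q-def : ∀ v → q v * (1 ⊔ deg v) ≡ M
    q-def v = sym (m∣n⇒n≡quotient*m (divides-M v))

    M>0 : 0 < M
    M>0 = n≢0⇒n>0 (≢-nonZero⁻¹ M {{product≢0 (Allₚ.map⁺ (All.universal (λ v → >-nonZero (m≤m⊔n 1 (deg v))) (allFin n)))}})

  q>0 : ∀ v → 0 < q v
  q>0 v with q v | q-def v
  ... | zero  | eq = ⊥-elim (<⇒≢ M>0 eq)
  ... | suc _ | _  = s≤s z≤n

  q-deg≤ : ∀ v → q v * deg v ≤ M
  q-deg≤ v = ≤-trans (*-monoʳ-≤ (q v) (m≤n⊔m 1 (deg v))) (≤-reflexive (q-def v))

  -- Detailed balance: after multiplication by `deg x`, the weight of a step depends on adjacency
  -- only and so is symmetric. The factor `A x v` excludes degree 0, where `q` uses 1 in place of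
  -- the degree.
  deg-q-A : ∀ x v → deg x * q x * A x v ≡ M * A x v
  deg-q-A x v with adj G x v in eq
  ... | false = trans (*-zeroʳ (deg x * q x)) (sym (*-zeroʳ M))
  ... | true  = cong (_* 1) (trans (*-comm (deg x) (q x))
                  (trans (cong (q x *_) (sym (m≤n⇒m⊔n≡n deg>0))) (q-def x)))
    where
    deg>0 : 1 ≤ deg x
    deg>0 = ≤-trans (≤-reflexive (sym (cong (λ b → if b then 1 else 0) eq))) (∈⇒≤∑ (A x) (∈-allFin v))

  -- `M ^ length l` times the probability that the random walk from `x` follows `l`.
  u : Fin n → List (Fin n) → ℕ
  u x []      = 1
  u x (v ∷ l) = q x * A x v * u v l

  u-++ : ∀ x c d → u x (c ++ d) ≡ u x c * u (end x c) d
  u-++ x []      d = sym (*-identityˡ (u x d))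
  u-++ x (v ∷ c) d rewrite u-++ v c d = sym (*-assoc (q x * A x v) (u v c) (u (end v c) d))

  ∑u-suc : ∀ x k (g : List (Fin n) → ℕ) →
    ∑ (words (suc k)) (λ l → u x l * g l) ≡
    ∑ (allFin n) (λ v → q x * A x v * ∑ (words k) (λ l → u v l * g (v ∷ l)))
  ∑u-suc x k g = trans (∑-words-suc k (λ l → u x l * g l)) (∑-cong (allFin n) (λ {v} _ →
    trans (∑-cong (words k) (λ {l} _ → *-assoc (q x * A x v) (u v l) (g (v ∷ l))))
          (∑-* (q x * A x v) (words k) (λ l → u v l * g (v ∷ l)))))

  ∑u-+ : ∀ x i k (g : List (Fin n) → ℕ) →
    ∑ (words (i + k)) (λ l → u x l * g l) ≡
    ∑ (words i) (λ c → u x c * ∑ (words k) (λ d → u (end x c) d * g (c ++ d)))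
  ∑u-+ x i k g = trans (∑-words-+ i k (λ l → u x l * g l)) (∑-cong (words i) (λ {c} _ →
    trans (∑-cong (words k) (λ {d} _ → trans (cong (_* g (c ++ d)) (u-++ x c d))
                                             (*-assoc (u x c) (u (end x c) d) (g (c ++ d)))))
          (∑-* (u x c) (words k) (λ d → u (end x c) d * g (c ++ d)))))

  ∑qA≤ : ∀ x → ∑ (allFin n) (λ v → q x * A x v) ≤ M
  ∑qA≤ x = ≤-trans (≤-reflexive (∑-* (q x) (allFin n) (A x))) (q-deg≤ x)

  -- Total probability is at most 1. It is lost only at vertices without neighbours, hence an
  -- inequality.
  ∑u≤ : ∀ x k → ∑ (words k) (u x) ≤ M ^ k
  ∑u≤ x zero    = ≤-refl
  ∑u≤ x (suc k) = begin
    ∑ (words (suc k)) (u x)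
      ≡⟨ ∑-words-suc k (u x) ⟩
    ∑ (allFin n) (λ v → ∑ (words k) (λ l → q x * A x v * u v l))
      ≡⟨ ∑-cong (allFin n) (λ {v} _ → ∑-* (q x * A x v) (words k) (u v)) ⟩
    ∑ (allFin n) (λ v → q x * A x v * ∑ (words k) (u v))
      ≤⟨ ∑-mono (allFin n) (λ {v} _ → *-monoʳ-≤ (q x * A x v) (∑u≤ v k)) ⟩
    ∑ (allFin n) (λ v → q x * A x v * M ^ k)
      ≡⟨ ∑-*ʳ (M ^ k) (allFin n) (λ v → q x * A x v) ⟩
    ∑ (allFin n) (λ v → q x * A x v) * M ^ k
      ≤⟨ *-monoˡ-≤ (M ^ k) (∑qA≤ x) ⟩
    M * M ^ k ∎
    where open ≤-Reasoning

  B : ℕ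
  B = ∑ (allFin n) deg

  -- Scaled expectation over the stationary random walk of length k.
  T : ℕ → (Fin n → List (Fin n) → ℕ) → ℕ
  T k g = ∑ (allFin n) (λ x → deg x * ∑ (words k) (λ l → u x l * g x l))

  onTail : (Fin n → List (Fin n) → ℕ) → Fin n → List (Fin n) → ℕ
  onTail g x []      = 0
  onTail g x (v ∷ l) = g v l

  T-mono : ∀ k {f g : Fin n → List (Fin n) → ℕ} →
    (∀ x {l} → length l ≡ k → 0 < u x l → f x l ≤ g x l) → T k f ≤ T k g
  T-mono k {f} {g} h = ∑-mono (allFin n) (λ {x} _ → *-monoʳ-≤ (deg x) (∑-mono (words k) (weighted x)))
    where
    weighted : ∀ x {l} → l ∈ words k → u x l * f x l ≤ u x l * g x l
    weighted x {l} l∈ with u x l in eq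
    ... | zero  = z≤n
    ... | suc m = *-monoʳ-≤ (suc m) (h x (∈-words k l∈) (subst (0 <_) (sym eq) (s≤s z≤n)))

  T-+ : ∀ k (f g : Fin n → List (Fin n) → ℕ) → T k (λ x l → f x l + g x l) ≡ T k f + T k g
  T-+ k f g = trans (∑-cong (allFin n) (λ {x} _ → trans (cong (deg x *_)
      (trans (∑-cong (words k) (λ {l} _ → *-distribˡ-+ (u x l) (f x l) (g x l)))
             (∑-+ (words k) (λ l → u x l * f x l) (λ l → u x l * g x l))))
      (*-distribˡ-+ (deg x) _ _)))
    (∑-+ (allFin n) (λ x → deg x * ∑ (words k) (λ l → u x l * f x l))
                    (λ x → deg x * ∑ (words k) (λ l → u x l * g x l)))

  -- Stationarity: by detailed balance the sum over the first vertex can be taken first, and it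
  -- gives `M * deg v` at the second vertex `v`.
  T-tail : ∀ k g → T (suc k) (onTail g) ≡ M * T k g
  T-tail k g = begin
    T (suc k) (onTail g)
      ≡⟨ ∑-cong (allFin n) (λ {x} _ → trans (cong (deg x *_) (∑u-suc x k (onTail g x)))
           (trans (sym (∑-* (deg x) (allFin n) _)) (∑-cong (allFin n) (λ {v} _ →
             trans (regroup (deg x) (q x) (A x v) (S v)) (cong (_* S v) (trans (deg-q-A x v) (cong (M *_) (A-sym x v)))))))) ⟩
    ∑ (allFin n) (λ x → ∑ (allFin n) (λ v → M * A v x * S v))
      ≡⟨ ∑-swap (allFin n) (allFin n) (λ x v → M * A v x * S v) ⟩
    ∑ (allFin n) (λ v → ∑ (allFin n) (λ x → M * A v x * S v))
      ≡⟨ ∑-cong (allFin n) (λ {v} _ → trans (∑-*ʳ (S v) (allFin n) (λ x → M * A v x))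
           (trans (cong (_* S v) (∑-* M (allFin n) (A v))) (*-assoc M (deg v) (S v)))) ⟩
    ∑ (allFin n) (λ v → M * (deg v * S v))
      ≡⟨ ∑-* M (allFin n) (λ v → deg v * S v) ⟩
    M * T k g ∎
    where
    open ≡-Reasoning
    S : Fin n → ℕ
    S v = ∑ (words k) (λ l → u v l * g v l)
    regroup : ∀ a b c d → a * (b * c * d) ≡ a * b * c * d
    regroup = solve-∀

  -- One more step after a walk of length k contributes at most M / c on average,
  -- as soon as it does so from every end vertex.
  T-extend : ∀ k c (f : Fin n → List (Fin n) → ℕ) (h : Fin n → List (Fin n) → List (Fin n) → ℕ) →
    (∀ x {l} → length l ≡ k → c * ∑ (words 1) (λ d → u (end x l) d * h x l d) ≤ M * f x l) →
    c * T (suc k) (λ x l → h x (take k l) (drop k l)) ≤ M * T k f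
  T-extend k c f h bound = begin
    c * T (suc k) (λ x l → h x (take k l) (drop k l))
      ≡⟨ cong (λ m → c * T m (λ x l → h x (take k l) (drop k l))) (+-comm 1 k) ⟩
    c * T (k + 1) (λ x l → h x (take k l) (drop k l))
      ≡⟨ sym (∑-* c (allFin n) _) ⟩
    ∑ (allFin n) (λ x → c * (deg x * ∑ (words (k + 1)) (λ l → u x l * h x (take k l) (drop k l))))
      ≤⟨ ∑-mono (allFin n) (λ {x} _ → step x) ⟩
    ∑ (allFin n) (λ x → M * (deg x * ∑ (words k) (λ l → u x l * f x l)))
      ≡⟨ ∑-* M (allFin n) _ ⟩
    M * T k f ∎
    where
    open ≤-Reasoning
    regroup : ∀ a b d → a * (b * d) ≡ b * (a * d)
    regroup = solve-∀
    cut : ∀ x {l} → l ∈ words k → ∀ d → h x (take k (l ++ d)) (drop k (l ++ d)) ≡ h x l d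
    cut x {l} l∈ d rewrite sym (∈-words k l∈) =
      cong₂ (h x) (take-length-++ l d) (drop-length-++ l d)
    step : ∀ x → c * (deg x * ∑ (words (k + 1)) (λ l → u x l * h x (take k l) (drop k l)))
               ≤ M * (deg x * ∑ (words k) (λ l → u x l * f x l))
    step x = begin
      c * (deg x * ∑ (words (k + 1)) (λ l → u x l * h x (take k l) (drop k l)))
        ≡⟨ cong (λ m → c * (deg x * m)) (∑u-+ x k 1 (λ l → h x (take k l) (drop k l))) ⟩
      c * (deg x * ∑ (words k) (λ l → u x l * ∑ (words 1) (λ d → u (end x l) d * h x (take k (l ++ d)) (drop k (l ++ d)))))
        ≡⟨ cong (λ m → c * (deg x * m)) (∑-cong (words k) (λ {l} l∈ → cong (u x l *_)
             (∑-cong (words 1) (λ {d} _ → cong (u (end x l) d *_) (cut x l∈ d))))) ⟩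
      c * (deg x * ∑ (words k) (λ l → u x l * ∑ (words 1) (λ d → u (end x l) d * h x l d)))
        ≡⟨ trans (regroup c (deg x) _) (cong (deg x *_) (sym (∑-* c (words k) _))) ⟩
      deg x * ∑ (words k) (λ l → c * (u x l * ∑ (words 1) (λ d → u (end x l) d * h x l d)))
        ≤⟨ *-monoʳ-≤ (deg x) (∑-mono (words k) (λ {l} l∈ → begin
             c * (u x l * ∑ (words 1) (λ d → u (end x l) d * h x l d))  ≡⟨ regroup c (u x l) _ ⟩
             u x l * (c * ∑ (words 1) (λ d → u (end x l) d * h x l d))  ≤⟨ *-monoʳ-≤ (u x l) (bound x (∈-words k l∈)) ⟩
             u x l * (M * f x l)                                        ≡⟨ regroup (u x l) M (f x l) ⟩
             M * (u x l * f x l)                                        ∎)) ⟩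
      deg x * ∑ (words k) (λ l → M * (u x l * f x l))
        ≡⟨ trans (cong (deg x *_) (∑-* M (words k) _)) (regroup (deg x) M _) ⟩
      M * (deg x * ∑ (words k) (λ l → u x l * f x l)) ∎

  -- Forgetting the first step lowers the length by one, since the constant 1 agrees with its
  -- `onTail` on nonempty lists. Equality is possible because isolated vertices have stationary
  -- weight 0.
  T-total : ∀ k → T k (λ _ _ → 1) ≡ M ^ k * B
  T-total zero    = trans (∑-cong (allFin n) (λ {x} _ → *-identityʳ (deg x))) (sym (*-identityˡ B))
  T-total (suc k) = trans (≤-antisym (T-mono (suc k) {λ _ _ → 1} {onTail (λ _ _ → 1)} below)
                                       (T-mono (suc k) {onTail (λ _ _ → 1)} {λ _ _ → 1} above))
    (trans (T-tail k (λ _ _ → 1)) (trans (cong (M *_) (T-total k)) (sym (*-assoc M (M ^ k) B))))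
    where
    below : ∀ x {l} → length l ≡ suc k → 0 < u x l → 1 ≤ onTail (λ _ _ → 1) x l
    below x {_ ∷ _} _ _ = ≤-refl
    above : ∀ x {l} → length l ≡ suc k → 0 < u x l → onTail (λ _ _ → 1) x l ≤ 1
    above x {_ ∷ _} _ _ = ≤-refl

  W : ℕ → Fin n → Fin n → ℕ
  W k x y = ∑ (words k) (λ l → # (end x l ≟ y) * u x l)

  ∑W≤ : ∀ k x → ∑ (allFin n) (W k x) ≤ M ^ k
  ∑W≤ k x = ≤-trans (∑-fibres≤ (words k) (end x) (u x)) (∑u≤ x k)

-- Good and admissible walks.

take-take-≤ : {A : Set} {i j : ℕ} → i ≤ j → (l : List A) → take i (take j l) ≡ take i l
take-take-≤ z≤n     l       = refl
take-take-≤ (s≤s p) []      = refl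
take-take-≤ (s≤s p) (v ∷ l) = cong (v ∷_) (take-take-≤ p l)

all-ends : ∀ {n} {P : Fin n → Set} x l → (∀ i → i < length l → P (end x (take (suc i) l))) → All P l
all-ends x []      h = []
all-ends x (v ∷ l) h = h 0 (s≤s z≤n) ∷ all-ends v l (λ i p → h (suc i) (s≤s p))

module Walks {n : ℕ} (G : Graph n) (d₀ X : ℕ) where

  open Weights G

  -- The odd exponents give `X * (D a * D b) = D (a + b)` for positive `a` and `b`. The spare factor
  -- `X` is what lets the bad walks between two ends outnumber those made of two good halves meeting
  -- at a given vertex.
  D : ℕ → ℕ
  D zero    = 1
  D (suc m) = X ^ suc (2 * m)

  Good : Fin n → List (Fin n) → Set
  Good x l = W (length l) x (end x l) ≤ D (length l) * u x l

  abstract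
    Good? : ∀ x l → Dec (Good x l)
    Good? x l = _ ≤? _

  good₀ : ∀ x → Good x []
  good₀ x = ≤-trans (≤-reflexive (trans (+-identityʳ _) (*-identityʳ _))) (#≤1 (x ≟ x))

  High : Fin n → Set
  High v = d₀ ≤ deg v

  -- For a walk of length j: it is a path through vertices of large degree,
  -- and all its proper subwalks are good.
  Adm : ℕ → Fin n → List (Fin n) → Set
  Adm zero    x l       = High x
  Adm (suc j) x []      = ⊥
  Adm (suc j) x (v ∷ l) =
    adj G x v ≡ true × (Adm j v l × Good v l) × (Adm j x (take j (v ∷ l)) × Good x (take j (v ∷ l))) × x ≢ end v l

  abstract
    Adm? : ∀ j x l → Dec (Adm j x l)
    Adm? zero    x l       = _ ≤? _
    Adm? (suc j) x []      = no id
    Adm? (suc j) x (v ∷ l) =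
      (adj G x v Boolₚ.≟ true) ×-dec (Adm? j v l ×-dec Good? v l) ×-dec
      (Adm? j x (take j (v ∷ l)) ×-dec Good? x (take j (v ∷ l))) ×-dec ¬? (x ≟ end v l)

  Okay Bad : ℕ → Fin n → List (Fin n) → Set
  Okay j x l = Adm j x l × Good x l
  Bad  j x l = Adm j x l × ¬ Good x l

  abstract
    Okay? : ∀ j x l → Dec (Okay j x l)
    Okay? j x l = Adm? j x l ×-dec Good? x l

    Bad? : ∀ j x l → Dec (Bad j x l)
    Bad? j x l = Adm? j x l ×-dec ¬? (Good? x l)

  A≡1 : ∀ {x v} → adj G x v ≡ true → A x v ≡ 1
  A≡1 eq = cong (λ b → if b then 1 else 0) eq

  adm-u>0 : ∀ j {x l} → length l ≡ j → Adm j x l → 0 < u x l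
  adm-u>0 zero    {l = []}        _   _ = s≤s z≤n
  adm-u>0 (suc j) {x} {v ∷ l} len (e , (a , _) , _) =
    *-mono-< {0} {_} {0} (*-mono-< {0} {_} {0} (q>0 x) (≤-reflexive (sym (A≡1 e)))) (adm-u>0 j (suc-injective len) a)

  adm-high : ∀ j {x l} → Adm j x l → High x
  adm-high zero    a = a
  adm-high (suc j) {l = _ ∷ _} (_ , _ , (a , _) , _) = adm-high j a

  adm-take : ∀ j {x l} → Adm j x l → ∀ {i} → i < j → Okay i x (take i l)
  adm-take (suc j) {x} {v ∷ l} (_ , _ , ok , _) {i} (s≤s i≤j) with m≤n⇒m<n∨m≡n i≤j
  ... | inj₂ refl = ok
  ... | inj₁ i<j  = subst (Okay i x) (take-take-≤ i≤j (v ∷ l)) (adm-take j (proj₁ ok) i<j)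

  -- At least `v` is removed, so what remains is a proper subwalk and therefore also good.
  adm-drop : ∀ k {x v} a {b} → Adm (suc (length a + k)) x (v ∷ a ++ b) → Okay k (end v a) b
  adm-drop k []      (_ , ok , _)      = ok
  adm-drop k (w ∷ a) (_ , (adm , _) , _) = adm-drop k a adm

  adm-≢end : ∀ j {x l} → Adm (suc j) x l → x ≢ end x l
  adm-≢end j {l = _ ∷ _} (_ , _ , _ , ne) = ne

  adm-end-high : ∀ j {x l} → length l ≡ j → Adm j x l → High (end x l)
  adm-end-high zero    {l = []}    _   a               = a
  adm-end-high (suc j) {l = _ ∷ _} len (_ , (a , _) , _) = adm-end-high j (suc-injective len) a

  -- Prefixes of an admissible walk are admissible, and admissibility separates the two ends of a
  -- walk of positive length.
  adm-distinct : ∀ j {x l} → length l ≡ j → Adm j x l → ∀ i → i < j → x ≢ end x (take (suc i) l)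
  adm-distinct (suc j) {x} {l} len a i (s≤s i≤j) with m≤n⇒m<n∨m≡n i≤j
  ... | inj₁ i<j  = adm-≢end i (proj₁ (adm-take (suc j) {l = l} a (s≤s i<j)))
  ... | inj₂ refl = subst (λ l′ → x ≢ end x l′) (sym (take-all (suc j) l (≤-reflexive len))) (adm-≢end j {l = l} a)

  adm-unique : ∀ j {x l} → length l ≡ j → Adm j x l → Unique (x ∷ l)
  adm-unique zero    {l = []}        _   a = [] ∷ []
  adm-unique (suc j) {x} {v ∷ l} len a@(_ , (a′ , _) , _) =
    all-ends x (v ∷ l) (λ i i< → adm-distinct (suc j) len a i (subst (i <_) len i<)) ∷ adm-unique j (suc-injective len) a′

  -- Each good walk carries at least the fraction `1 / D k` of `W k x y`, so there are at most `D k`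
  -- of them. If `W k x y` is 0 there are none, because admissible walks have positive weight.
  count-okay : ∀ k x y → ∑ (words k) (λ l → # (end x l ≟ y) * # (Okay? k x l)) ≤ D k
  count-okay k x y with W k x y in eq
  ... | zero  = ≤-trans (≤-reflexive (∑-zero (words k) none)) z≤n
    where
    none : ∀ {l} → l ∈ words k → # (end x l ≟ y) * # (Okay? k x l) ≡ 0
    none {l} l∈ with Okay? k x l
    ... | no _ = *-zeroʳ (# (end x l ≟ y))
    ... | yes (a , _) = trans (*-identityʳ _) (m*n≡0⇒m≡0 (# (end x l ≟ y)) (u x l)
            {{>-nonZero (adm-u>0 k (∈-words k l∈) a)}}
            (n≤0⇒n≡0 (subst (# (end x l ≟ y) * u x l ≤_) eq (∈⇒≤∑ (λ l → # (end x l ≟ y) * u x l) l∈))))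
  ... | suc w = *-cancelˡ-≤ (suc w) (begin
    suc w * ∑ (words k) (λ l → # (end x l ≟ y) * # (Okay? k x l))
      ≡⟨ sym (∑-* (suc w) (words k) _) ⟩
    ∑ (words k) (λ l → suc w * (# (end x l ≟ y) * # (Okay? k x l)))
      ≤⟨ ∑-mono (words k) bound ⟩
    ∑ (words k) (λ l → D k * (# (end x l ≟ y) * u x l))
      ≡⟨ ∑-* (D k) (words k) _ ⟩
    D k * W k x y
      ≡⟨ trans (cong (D k *_) eq) (*-comm (D k) (suc w)) ⟩
    suc w * D k ∎)
    where
    open ≤-Reasoning
    bound : ∀ {l} → l ∈ words k → suc w * (# (end x l ≟ y) * # (Okay? k x l)) ≤ D k * (# (end x l ≟ y) * u x l)
    bound {l} l∈ with end x l ≟ y | Okay? k x l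
    ... | no _     | _     = ≤-trans (≤-reflexive (*-zeroʳ (suc w))) z≤n
    ... | yes _    | no _  = ≤-trans (≤-reflexive (*-zeroʳ (suc w))) z≤n
    ... | yes refl | yes (_ , good) = begin
      suc w * 1              ≡⟨ trans (*-identityʳ (suc w)) (sym eq) ⟩
      W k x (end x l)        ≤⟨ subst (λ k → W k x (end x l) ≤ D k * u x l) (∈-words k l∈) good ⟩
      D k * u x l            ≡⟨ cong (D k *_) (sym (*-identityˡ (u x l))) ⟩
      D k * (1 * u x l)      ∎

  q*d₀≤M : ∀ {v} → High v → q v * d₀ ≤ M
  q*d₀≤M {v} h = ≤-trans (*-monoʳ-≤ (q v) h) (q-deg≤ v)

-- If bad walks are rare, the degree sum is small.

rate : ℕ → ℕ
rate zero    = 1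
rate (suc j) = 2 * rate j + 2

rate>0 : ∀ j → 0 < rate j
rate>0 zero    = s≤s z≤n
rate>0 (suc j) = ≤-trans (s≤s z≤n) (m≤n+m 2 (2 * rate j))

module Density {n : ℕ} (G : Graph n) (d₀ X : ℕ) where

  open Weights G
  open Walks G d₀ X

  notOkay : ℕ → Fin n → List (Fin n) → ℕ
  notOkay j x l = # (¬? (Okay? j x l))

  -- The event that the last step `d` returns to the start. Admissibility of `a` ensures that this
  -- step leaves a vertex of large degree.
  closing : ℕ → Fin n → List (Fin n) → List (Fin n) → ℕ
  closing j x a d = # (Adm? j x a) * # (x ≟ end (end x a) d)

  u>0⇒adj : ∀ x v l → 0 < u x (v ∷ l) → adj G x v ≡ true
  u>0⇒adj x v l p with adj G x v
  ... | true  = refl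
  ... | false = ⊥-elim (n≮0 (subst (λ m → 0 < m * u v l) (*-zeroʳ (q x)) p))

  -- A walk of positive weight can fail in four ways, in the order of the summands: its tail fails,
  -- its initial part fails, it closes up, or it is admissible without being good.
  notOkay-suc : ∀ j x {l} → length l ≡ suc j → 0 < u x l →
    notOkay (suc j) x l ≤ (onTail (notOkay j) x l + notOkay j x (take j l))
                          + (closing j x (take j l) (drop j l) + # (Bad? (suc j) x l))
  notOkay-suc j x {v ∷ l} len u>0 with Okay? (suc j) x (v ∷ l)
  ... | yes _ = z≤n
  ... | no ¬ok with Okay? j v l
  ...   | no _ = s≤s z≤n
  ...   | yes ok₁ with Okay? j x (take j (v ∷ l))
  ...     | no _ = s≤s z≤n
  ...     | yes ok₂ with x ≟ end v l
  ...       | yes eq = m≤n⇒m≤n+o (# (Bad? (suc j) x (v ∷ l))) (≤-reflexive (sym (trans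
                (cong₂ _*_ (#-yes (Adm? j x (take j (v ∷ l))) (proj₁ ok₂))
                           (#-yes (x ≟ _) (trans eq (trans (cong (end x) (sym (take++drop≡id j (v ∷ l))))
                                                           (end-++ x (take j (v ∷ l)) (drop j (v ∷ l))))))) refl)))
  ...       | no ne = m≤n⇒m≤o+n (closing j x (take j (v ∷ l)) (drop j (v ∷ l)))
                (≤-reflexive (sym (#-yes (Bad? (suc j) x (v ∷ l)) (adm , λ good → ¬ok (adm , good)))))
    where
    adm : Adm (suc j) x (v ∷ l)
    adm = u>0⇒adj x v l u>0 , ok₁ , ok₂ , ne

  -- The end of an admissible walk has degree at least `d₀`, so the next step hits the single vertex
  -- `x` with probability at most `1 / d₀`.
  T-closing : ∀ j → d₀ * T (suc j) (λ x l → closing j x (take j l) (drop j l)) ≤ M * T j (λ _ _ → 1)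
  T-closing j = T-extend j d₀ (λ _ _ → 1) (closing j) bound
    where
    open ≤-Reasoning
    bound : ∀ x {a} → length a ≡ j → d₀ * ∑ (words 1) (λ d → u (end x a) d * closing j x a d) ≤ M * 1
    bound x {a} len with Adm? j x a
    ... | no _    = ≤-trans (≤-reflexive (trans (cong (d₀ *_) (∑-zero (words 1) (λ {d} _ → *-zeroʳ (u (end x a) d)))) (*-zeroʳ d₀))) z≤n
    ... | yes adm = begin
      d₀ * ∑ (words 1) (λ d → u e d * (1 * # (x ≟ end e d)))
        ≡⟨ cong (d₀ *_) (∑u-suc e 0 (λ d → 1 * # (x ≟ end e d))) ⟩
      d₀ * ∑ (allFin n) (λ v → q e * A e v * (1 * (1 * # (x ≟ v)) + 0))
        ≤⟨ *-monoʳ-≤ d₀ (∑-mono (allFin n) (λ {v} _ → *-mono-≤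
             (≤-trans (*-monoʳ-≤ (q e) (A≤1 e v)) (≤-reflexive (*-identityʳ (q e)))) (≤-reflexive (simp (# (x ≟ v)))))) ⟩
      d₀ * ∑ (allFin n) (λ v → q e * # (x ≟ v))
        ≡⟨ cong (d₀ *_) (∑-* (q e) (allFin n) (λ v → # (x ≟ v))) ⟩
      d₀ * (q e * ∑ (allFin n) (λ v → # (x ≟ v)))
        ≤⟨ *-monoʳ-≤ d₀ (*-monoʳ-≤ (q e) (∑-≟≤1 x)) ⟩
      d₀ * (q e * 1)
        ≡⟨ trans (cong (d₀ *_) (*-identityʳ (q e))) (*-comm d₀ (q e)) ⟩
      q e * d₀
        ≤⟨ q*d₀≤M (adm-end-high j len adm) ⟩
      M
        ≡⟨ sym (*-identityʳ M) ⟩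
      M * 1 ∎
      where
      e : Fin n
      e = end x a
      simp : ∀ a → 1 * (1 * a) + 0 ≡ a
      simp = solve-∀

  T-init : ∀ j (f : Fin n → List (Fin n) → ℕ) → T (suc j) (λ x l → f x (take j l)) ≤ M * T j f
  T-init j f = ≤-trans (≤-reflexive (sym (*-identityˡ _))) (T-extend j 1 f (λ x a _ → f x a) bound)
    where
    open ≤-Reasoning
    bound : ∀ x {a} → length a ≡ j → 1 * ∑ (words 1) (λ d → u (end x a) d * f x a) ≤ M * f x a
    bound x {a} _ = begin
      1 * ∑ (words 1) (λ d → u (end x a) d * f x a)
        ≡⟨ trans (*-identityˡ _) (∑-*ʳ (f x a) (words 1) (u (end x a))) ⟩
      ∑ (words 1) (u (end x a)) * f x a
        ≤⟨ *-monoˡ-≤ (f x a) (≤-trans (∑u≤ (end x a) 1) (≤-reflexive (*-identityʳ M))) ⟩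
      M * f x a ∎

  module _ (s E : ℕ) (E≤d₀ : E ≤ d₀) (En≤B : E * (n * d₀) ≤ B)
           (few-bad : ∀ j x → j ≤ s → E * ∑ (words j) (λ l → u x l * # (Bad? j x l)) ≤ M ^ j) where

    T-bad : ∀ j → j ≤ s → E * T j (λ x l → # (Bad? j x l)) ≤ M ^ j * B
    T-bad j j≤s = begin
      E * T j (λ x l → # (Bad? j x l))
        ≡⟨ sym (∑-* E (allFin n) _) ⟩
      ∑ (allFin n) (λ x → E * (deg x * ∑ (words j) (λ l → u x l * # (Bad? j x l))))
        ≤⟨ ∑-mono (allFin n) (λ {x} _ → ≤-trans (≤-reflexive (regroup E (deg x) _)) (*-monoʳ-≤ (deg x) (few-bad j x j≤s))) ⟩
      ∑ (allFin n) (λ x → deg x * M ^ j)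
        ≡⟨ trans (∑-*ʳ (M ^ j) (allFin n) deg) (*-comm B (M ^ j)) ⟩
      M ^ j * B ∎
      where
      open ≤-Reasoning
      regroup : ∀ a b d → a * (b * d) ≡ b * (a * d)
      regroup = solve-∀

    -- Union bound from `notOkay-suc`: by stationarity the two shorter subwalks contribute `rate j`
    -- each, while closing up and badness cost at most one unit each. This is the recursion of
    -- `rate`.
    T-notOkay : ∀ j → j ≤ s → E * T j (notOkay j) ≤ rate j * (M ^ j * B)
    T-notOkay zero _ = begin
      E * T 0 (notOkay 0)
        ≤⟨ *-monoʳ-≤ E (∑-mono (allFin n) (λ {x} _ → low x)) ⟩
      E * ∑ (allFin n) (λ _ → d₀)
        ≡⟨ cong (E *_) (∑-allFin-const {n} d₀) ⟩
      E * (n * d₀)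
        ≤⟨ En≤B ⟩
      B
        ≡⟨ sym (trans (*-identityˡ (1 * B)) (*-identityˡ B)) ⟩
      1 * (1 * B) ∎
      where
      open ≤-Reasoning
      -- A walk of length 0 can fail only by low degree, so each failing vertex adds at most `d₀` to
      -- the sum.
      low : ∀ x → deg x * (1 * notOkay 0 x [] + 0) ≤ d₀
      low x with Okay? 0 x []
      ... | yes _  = ≤-trans (≤-reflexive (*-zeroʳ (deg x))) z≤n
      ... | no ¬ok = ≤-trans (≤-reflexive (*-identityʳ (deg x))) (<⇒≤ (≰⇒> (λ h → ¬ok (h , good₀ x))))
    T-notOkay (suc j) j<s = begin
      E * T (suc j) (notOkay (suc j))
        ≤⟨ *-monoʳ-≤ E (T-mono (suc j) {notOkay (suc j)} {λ x l → (onTail (notOkay j) x l + notOkay j x (take j l))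
                              + (closing j x (take j l) (drop j l) + # (Bad? (suc j) x l))} (notOkay-suc j)) ⟩
      E * T (suc j) (λ x l → (onTail (notOkay j) x l + notOkay j x (take j l))
                              + (closing j x (take j l) (drop j l) + # (Bad? (suc j) x l)))
        ≡⟨ cong (E *_) (trans (T-+ (suc j) (λ x l → onTail (notOkay j) x l + notOkay j x (take j l))
                                          (λ x l → closing j x (take j l) (drop j l) + # (Bad? (suc j) x l)))
             (cong₂ _+_ (T-+ (suc j) (onTail (notOkay j)) (λ x l → notOkay j x (take j l)))
                        (T-+ (suc j) (λ x l → closing j x (take j l) (drop j l)) (λ x l → # (Bad? (suc j) x l))))) ⟩
      E * ((T (suc j) (onTail (notOkay j)) + T (suc j) (λ x l → notOkay j x (take j l))) + (t₃ + t₄))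
        ≤⟨ *-monoʳ-≤ E (+-monoˡ-≤ (t₃ + t₄) (+-mono-≤ (≤-reflexive (T-tail j (notOkay j))) (T-init j (notOkay j)))) ⟩
      E * ((M * N + M * N) + (t₃ + t₄))
        ≡⟨ regroup E M N t₃ t₄ ⟩
      2 * (M * (E * N)) + (E * t₃ + E * t₄)
        ≤⟨ +-mono-≤ (*-monoʳ-≤ 2 (*-monoʳ-≤ M (T-notOkay j (<⇒≤ j<s)))) (+-mono-≤ bound₃ (T-bad (suc j) j<s)) ⟩
      2 * (M * (rate j * (M ^ j * B))) + (M * (M ^ j * B) + M * M ^ j * B)
        ≡⟨ collect M (rate j) (M ^ j) B ⟩
      (2 * rate j + 2) * (M * M ^ j * B) ∎
      where
      open ≤-Reasoning
      N t₃ t₄ : ℕ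
      N = T j (notOkay j)
      t₃ = T (suc j) (λ x l → closing j x (take j l) (drop j l))
      t₄ = T (suc j) (λ x l → # (Bad? (suc j) x l))
      regroup : ∀ e m a b c → e * ((m * a + m * a) + (b + c)) ≡ 2 * (m * (e * a)) + (e * b + e * c)
      regroup = solve-∀
      collect : ∀ m r p b → 2 * (m * (r * (p * b))) + (m * (p * b) + m * p * b) ≡ (2 * r + 2) * (m * p * b)
      collect = solve-∀
      bound₃ : E * t₃ ≤ M * (M ^ j * B)
      bound₃ = ≤-trans (*-monoˡ-≤ t₃ E≤d₀) (≤-trans (T-closing j) (≤-reflexive (cong (M *_) (T-total j))))

  -- Each of the `j` factors `q v` belongs to a vertex of degree at least `d₀`, hence is at most
  -- `M / d₀`.
  adm-u≤ : ∀ j {x l} → length l ≡ j → Adm j x l → u x l * d₀ ^ j ≤ M ^ j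
  adm-u≤ zero    {l = []}    _   _                   = ≤-refl
  adm-u≤ (suc j) {x} {v ∷ l} len a@(_ , (a′ , _) , _) = begin
    q x * A x v * u v l * (d₀ * d₀ ^ j)   ≡⟨ regroup (q x) (A x v) (u v l) d₀ (d₀ ^ j) ⟩
    A x v * (q x * d₀ * (u v l * d₀ ^ j)) ≤⟨ *-mono-≤ (A≤1 x v) (*-mono-≤ (q*d₀≤M (adm-high (suc j) {l = v ∷ l} a)) (adm-u≤ j (suc-injective len) a′)) ⟩
    1 * (M * M ^ j)                       ≡⟨ *-identityˡ _ ⟩
    M * M ^ j                             ∎
    where
    open ≤-Reasoning
    regroup : ∀ a b c d e → a * b * c * (d * e) ≡ b * (a * d * (c * e))
    regroup = solve-∀

  -- The stationary weight `deg x` cancels the first factor `q x`, and the `k` remaining factors are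
  -- at most `M / d₀`; hence `d₀ ^ k` for walks of length `suc k`. It remains to count the walks, at
  -- most `D (suc k)` for each pair of ends.
  T-okay≤ : ∀ k → d₀ ^ k * T (suc k) (λ x l → # (Okay? (suc k) x l)) ≤ M ^ suc k * (n * (n * D (suc k)))
  T-okay≤ k = begin
    d₀ ^ k * T (suc k) (λ x l → # (Okay? (suc k) x l))
      ≡⟨ sym (∑-* (d₀ ^ k) (allFin n) _) ⟩
    ∑ (allFin n) (λ x → d₀ ^ k * (deg x * ∑ (words (suc k)) (λ l → u x l * # (Okay? (suc k) x l))))
      ≡⟨ ∑-cong (allFin n) (λ {x} _ → trans (sym (*-assoc (d₀ ^ k) (deg x) _)) (sym (∑-* (d₀ ^ k * deg x) (words (suc k)) (λ l → u x l * # (Okay? (suc k) x l))))) ⟩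
    ∑ (allFin n) (λ x → ∑ (words (suc k)) (λ l → d₀ ^ k * deg x * (u x l * # (Okay? (suc k) x l))))
      ≤⟨ ∑-mono (allFin n) (λ {x} _ → ∑-mono (words (suc k)) (λ {l} l∈ → single x l (∈-words (suc k) l∈))) ⟩
    ∑ (allFin n) (λ x → ∑ (words (suc k)) (λ l → M ^ suc k * # (Okay? (suc k) x l)))
      ≡⟨ trans (∑-cong (allFin n) (λ {x} _ → ∑-* (M ^ suc k) (words (suc k)) (λ l → # (Okay? (suc k) x l)))) (∑-* (M ^ suc k) (allFin n) _) ⟩
    M ^ suc k * ∑ (allFin n) (λ x → ∑ (words (suc k)) (λ l → # (Okay? (suc k) x l)))
      ≤⟨ *-monoʳ-≤ (M ^ suc k) (∑-mono (allFin n) (λ {x} _ → ≤-trans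
           (≤∑-fibres (words (suc k)) (end x) (λ l → # (Okay? (suc k) x l)))
           (∑-mono (allFin n) (λ {y} _ → count-okay (suc k) x y)))) ⟩
    M ^ suc k * ∑ (allFin n) (λ _ → ∑ (allFin n) (λ _ → D (suc k)))
      ≡⟨ cong (M ^ suc k *_) (trans (∑-allFin-const {n} (∑ (allFin n) (λ _ → D (suc k)))) (cong (n *_) (∑-allFin-const {n} (D (suc k))))) ⟩
    M ^ suc k * (n * (n * D (suc k))) ∎
    where
    open ≤-Reasoning
    regroup : ∀ a b c e f → a * b * (c * e * f * 1) ≡ b * c * e * (f * a)
    regroup = solve-∀
    single : ∀ x l → length l ≡ suc k → d₀ ^ k * deg x * (u x l * # (Okay? (suc k) x l)) ≤ M ^ suc k * # (Okay? (suc k) x l)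
    single x (v ∷ l) len with Okay? (suc k) x (v ∷ l)
    ... | no _ = ≤-trans (≤-reflexive (trans (cong (d₀ ^ k * deg x *_) (*-zeroʳ (u x (v ∷ l)))) (*-zeroʳ (d₀ ^ k * deg x)))) z≤n
    ... | yes ((_ , (a , _) , _) , _) = begin
      d₀ ^ k * deg x * (q x * A x v * u v l * 1)   ≡⟨ regroup (d₀ ^ k) (deg x) (q x) (A x v) (u v l) ⟩
      deg x * q x * A x v * (u v l * d₀ ^ k)       ≡⟨ cong (_* (u v l * d₀ ^ k)) (deg-q-A x v) ⟩
      M * A x v * (u v l * d₀ ^ k)                 ≤⟨ *-mono-≤ (*-monoʳ-≤ M (A≤1 x v)) (adm-u≤ k (suc-injective len) a) ⟩
      M * 1 * M ^ k                                ≡⟨ trans (cong (_* M ^ k) (*-identityʳ M)) (sym (*-identityʳ (M * M ^ k))) ⟩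
      M * M ^ k * 1                                ∎

  -- The factor `2 * rate (suc k)` confines the walks that are not okay to half of the total weight
  -- `M ^ suc k * B`; the other half is bounded by `T-okay≤`.
  degree-sum-bound : ∀ k → 2 * rate (suc k) ≤ d₀ → 2 * rate (suc k) * (n * d₀) ≤ B →
    (∀ j x → j ≤ suc k → 2 * rate (suc k) * ∑ (words j) (λ l → u x l * # (Bad? j x l)) ≤ M ^ j) →
    d₀ ^ k * B ≤ 2 * (n * (n * D (suc k)))
  degree-sum-bound k E≤d₀ En≤B few-bad = *-cancelˡ-≤ (M ^ suc k) {{m^n≢0 M (suc k) {{>-nonZero M>0}}}} (begin
    M ^ suc k * (d₀ ^ k * B)          ≡⟨ regroup (M ^ suc k) (d₀ ^ k) B ⟩
    d₀ ^ k * (M ^ suc k * B)          ≤⟨ *-monoʳ-≤ (d₀ ^ k) half ⟩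
    d₀ ^ k * (2 * Ok)                 ≡⟨ regroup (d₀ ^ k) 2 Ok ⟩
    2 * (d₀ ^ k * Ok)                 ≤⟨ *-monoʳ-≤ 2 (T-okay≤ k) ⟩
    2 * (M ^ suc k * (n * (n * D (suc k)))) ≡⟨ regroup 2 (M ^ suc k) _ ⟩
    M ^ suc k * (2 * (n * (n * D (suc k)))) ∎)
    where
    open ≤-Reasoning
    regroup : ∀ a b d → a * (b * d) ≡ b * (a * d)
    regroup = solve-∀
    Ok N t : ℕ
    Ok = T (suc k) (λ x l → # (Okay? (suc k) x l))
    N  = T (suc k) (notOkay (suc k))
    t  = M ^ suc k * B
    dichotomy : ∀ x {l} → length l ≡ suc k → 0 < u x l → 1 ≤ notOkay (suc k) x l + # (Okay? (suc k) x l)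
    dichotomy x {l} _ _ with Okay? (suc k) x l
    ... | yes _ = ≤-refl
    ... | no _  = ≤-refl
    t≤ : t ≤ N + Ok
    t≤ = ≤-trans (≤-reflexive (sym (T-total (suc k))))
        (≤-trans (T-mono (suc k) {λ _ _ → 1} {λ x l → notOkay (suc k) x l + # (Okay? (suc k) x l)} dichotomy)
                 (≤-reflexive (T-+ (suc k) (notOkay (suc k)) (λ x l → # (Okay? (suc k) x l)))))
    2N≤t : 2 * N ≤ t
    2N≤t = *-cancelˡ-≤ (rate (suc k)) {{>-nonZero (rate>0 (suc k))}}
      (≤-trans (≤-reflexive (trans (regroup (rate (suc k)) 2 N) (sym (*-assoc 2 (rate (suc k)) N))))
               (T-notOkay (suc k) (2 * rate (suc k)) E≤d₀ En≤B few-bad (suc k) ≤-refl))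
    half : t ≤ 2 * Ok
    half = +-cancelˡ-≤ t t (2 * Ok) (begin
      t + t              ≡⟨ cong (t +_) (sym (+-identityʳ t)) ⟩
      2 * t              ≤⟨ *-monoʳ-≤ 2 t≤ ⟩
      2 * (N + Ok)       ≡⟨ *-distribˡ-+ 2 N Ok ⟩
      2 * N + 2 * Ok     ≤⟨ +-monoˡ-≤ (2 * Ok) 2N≤t ⟩
      t + 2 * Ok         ∎)

-- Discarding walks that lie in poor fibres.

*-pos⁻ˡ : ∀ a {b} → 0 < a * b → 0 < a
*-pos⁻ˡ (suc a) _ = s≤s z≤n

*-pos⁻ʳ : ∀ a {b} → 0 < a * b → 0 < b
*-pos⁻ʳ a {zero}  h = ⊥-elim (n≮0 (subst (0 <_) (*-zeroʳ a) h))
*-pos⁻ʳ a {suc b} _ = s≤s z≤n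

*-swapˡ : ∀ a b c → a * (b * c) ≡ b * (a * c)
*-swapˡ = solve-∀

-- Either `Q` has weight at least `w / H`, and then no element of positive weight is discarded, or
-- all of `Q` weighs less than `w / H` and may be lost.
fibre-loss : {A : Set} (xs : List A) (f : A → ℕ) (w H : ℕ) {Q C : A → Set} (Q? : Decidable Q) (C? : Decidable C) →
  (∀ {a} → a ∈ xs → 0 < f a → w ≤ H * ∑ xs (λ a → f a * # (Q? a)) → C a) →
  H * ∑ xs (λ a → f a * # (Q? a ×-dec ¬? (C? a))) ≤ w
fibre-loss xs f w H Q? C? rich with w ≤? H * ∑ xs (λ a → f a * # (Q? a))
... | yes w≤ = ≤-trans (≤-reflexive (trans (cong (H *_) (∑-zero xs none)) (*-zeroʳ H))) z≤n
  where
  none : ∀ {a} → a ∈ xs → f a * # (Q? a ×-dec ¬? (C? a)) ≡ 0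
  none {a} a∈ with f a in eq
  ... | zero  = refl
  ... | suc m = trans (cong (suc m *_) (#-no (Q? a ×-dec ¬? (C? a))
                  (λ (_ , ¬c) → ¬c (rich a∈ (subst (0 <_) (sym eq) (s≤s z≤n)) w≤)))) (*-zeroʳ (suc m))
... | no w≰ = ≤-trans (*-monoʳ-≤ H (∑-mono xs (λ {a} _ → *-monoʳ-≤ (f a) (#-mono (Q? a ×-dec ¬? (C? a)) (Q? a) proj₁))))
                      (<⇒≤ (≰⇒> w≰))

module RichFibres {n : ℕ} (G : Graph n) (d₀ X : ℕ) (x : Fin n) (p i₀ H : ℕ) (i₀≤ : i₀ ≤ suc p) where

  open Weights G
  open Walks G d₀ X

  j : ℕ
  j = suc p

  module _ {Q : List (Fin n) → Set} (Q? : Decidable Q) where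

    -- The comparison is with all walks to the same end, since their total weight is what badness
    -- refers to.
    EndRich : List (Fin n) → Set
    EndRich l = W j x (end x l) ≤ H * ∑ (words j) (λ l′ → # (end x l′ ≟ end x l) * u x l′ * # (Q? l′))

    -- The left side is the upper bound from `∑u≤` for the weight of all extensions of the prefix to
    -- length `j`.
    PrefixRich : ℕ → List (Fin n) → Set
    PrefixRich i l = M ^ (j ∸ i) * u x (take i l) ≤
      H * ∑ (words (j ∸ i)) (λ d → u x (take i l ++ d) * # (Q? (take i l ++ d)))

    abstract
      EndRich? : Decidable EndRich
      EndRich? l = _ ≤? _

      PrefixRich? : ∀ i → Decidable (PrefixRich i)
      PrefixRich? i l = _ ≤? _

    -- `fibre-loss` is applied to each end vertex `y`; the fibre weights `W j x y` add up to at most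
    -- `M ^ j`.
    end-loss : H * ∑ (words j) (λ l → u x l * # (Q? l ×-dec ¬? (EndRich? l))) ≤ M ^ j
    end-loss = begin
      H * ∑ (words j) (λ l → u x l * # (bad? l))
        ≤⟨ *-monoʳ-≤ H (≤∑-fibres (words j) (end x) (λ l → u x l * # (bad? l))) ⟩
      H * ∑ (allFin n) (λ y → ∑ (words j) (λ l → # (end x l ≟ y) * (u x l * # (bad? l))))
        ≡⟨ trans (cong (H *_) (∑-cong (allFin n) (λ {y} _ → ∑-cong (words j) (λ {l} _ →
             sym (*-assoc (# (end x l ≟ y)) (u x l) (# (bad? l)))))))
           (sym (∑-* H (allFin n) (λ y → ∑ (words j) (λ l → # (end x l ≟ y) * u x l * # (bad? l))))) ⟩
      ∑ (allFin n) (λ y → H * ∑ (words j) (λ l → # (end x l ≟ y) * u x l * # (bad? l)))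
        ≤⟨ ∑-mono (allFin n) (λ {y} _ → fibre-loss (words j) (λ l → # (end x l ≟ y) * u x l) (W j x y) H Q? EndRich? (rich y)) ⟩
      ∑ (allFin n) (W j x)
        ≤⟨ ∑W≤ j x ⟩
      M ^ j ∎
      where
      open ≤-Reasoning
      bad? : Decidable (λ l → Q l × ¬ EndRich l)
      bad? l = Q? l ×-dec ¬? (EndRich? l)
      rich : ∀ y {l} → l ∈ words j → 0 < # (end x l ≟ y) * u x l →
             W j x y ≤ H * ∑ (words j) (λ l → # (end x l ≟ y) * u x l * # (Q? l)) → EndRich l
      rich y {l} _ pos h with end x l ≟ y
      ... | yes refl = h
      ... | no _     = ⊥-elim (n≮0 pos)

    prefix-loss : ∀ i → i ≤ j → H * ∑ (words j) (λ l → u x l * # (Q? l ×-dec ¬? (PrefixRich? i l))) ≤ M ^ j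
    prefix-loss i i≤j = begin
      H * ∑ (words j) (λ l → u x l * # (bad? l))
        ≡⟨ cong (λ k → H * ∑ (words k) (λ l → u x l * # (bad? l))) (sym (m+[n∸m]≡n i≤j)) ⟩
      H * ∑ (words (i + k)) (λ l → u x l * # (bad? l))
        ≡⟨ trans (cong (H *_) (∑-words-+ i k (λ l → u x l * # (bad? l))))
                 (sym (∑-* H (words i) (λ c → ∑ (words k) (λ d → u x (c ++ d) * # (bad? (c ++ d)))))) ⟩
      ∑ (words i) (λ c → H * ∑ (words k) (λ d → u x (c ++ d) * # (bad? (c ++ d))))
        ≤⟨ ∑-mono (words i) (λ {c} c∈ → fibre-loss (words k) (λ d → u x (c ++ d)) (M ^ k * u x c) H
             (λ d → Q? (c ++ d)) (λ d → PrefixRich? i (c ++ d)) (λ {d} _ _ → rich c d (∈-words i c∈))) ⟩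
      ∑ (words i) (λ c → M ^ k * u x c)
        ≡⟨ ∑-* (M ^ k) (words i) (u x) ⟩
      M ^ k * ∑ (words i) (u x)
        ≤⟨ *-monoʳ-≤ (M ^ k) (∑u≤ x i) ⟩
      M ^ k * M ^ i
        ≡⟨ trans (sym (^-distribˡ-+-* M k i)) (cong (M ^_) (m∸n+n≡m i≤j)) ⟩
      M ^ j ∎
      where
      open ≤-Reasoning
      k : ℕ
      k = j ∸ i
      bad? : Decidable (λ l → Q l × ¬ PrefixRich i l)
      bad? l = Q? l ×-dec ¬? (PrefixRich? i l)
      rich : ∀ c d → length c ≡ i →
             M ^ k * u x c ≤ H * ∑ (words k) (λ d → u x (c ++ d) * # (Q? (c ++ d))) → PrefixRich i (c ++ d)
      rich c d refl h rewrite take-length-++ c d = h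

    -- One round of discarding, for three kinds of fibre: a common end, a common prefix of length
    -- `i₀` where the paths branch off, and a common prefix lacking only the last vertex.
    Step : List (Fin n) → Set
    Step l = Q l × EndRich l × PrefixRich i₀ l × PrefixRich p l

    Step? : Decidable Step
    Step? l = Q? l ×-dec (EndRich? l ×-dec (PrefixRich? i₀ l ×-dec PrefixRich? p l))

    mass : ℕ
    mass = ∑ (words j) (λ l → u x l * # (Q? l))

  step-loss : ∀ {Q : List (Fin n) → Set} (Q? : Decidable Q) → H * mass Q? ≤ H * mass (Step? Q?) + 3 * M ^ j
  step-loss {Q} Q? = begin
    H * mass Q?
      ≤⟨ *-monoʳ-≤ H (∑-mono (words j) (λ {l} _ → ≤-trans (*-monoʳ-≤ (u x l) (split l))
           (≤-reflexive (distrib (u x l) (# (Step? Q? l)) (# (e? l)) (# (a? l)) (# (b? l)))))) ⟩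
    H * ∑ (words j) (λ l → u x l * # (Step? Q? l) + (u x l * # (e? l) + (u x l * # (a? l) + u x l * # (b? l))))
      ≡⟨ cong (H *_) (trans (∑-+ (words j) (λ l → u x l * # (Step? Q? l)) (λ l → u x l * # (e? l) + (u x l * # (a? l) + u x l * # (b? l))))
           (cong (mass (Step? Q?) +_) (trans (∑-+ (words j) (λ l → u x l * # (e? l)) (λ l → u x l * # (a? l) + u x l * # (b? l)))
             (cong (∑ (words j) (λ l → u x l * # (e? l)) +_) (∑-+ (words j) (λ l → u x l * # (a? l)) (λ l → u x l * # (b? l))))))) ⟩
    H * (mass (Step? Q?) + (∑ (words j) (λ l → u x l * # (e? l)) + (∑ (words j) (λ l → u x l * # (a? l)) + ∑ (words j) (λ l → u x l * # (b? l)))))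
      ≡⟨ distrib H (mass (Step? Q?)) _ _ _ ⟩
    H * mass (Step? Q?) + (H * ∑ (words j) (λ l → u x l * # (e? l)) + (H * ∑ (words j) (λ l → u x l * # (a? l)) + H * ∑ (words j) (λ l → u x l * # (b? l))))
      ≤⟨ +-monoʳ-≤ (H * mass (Step? Q?)) (+-mono-≤ (end-loss Q?) (+-mono-≤ (prefix-loss Q? i₀ i₀≤) (prefix-loss Q? p (n≤1+n p)))) ⟩
    H * mass (Step? Q?) + (M ^ j + (M ^ j + M ^ j))
      ≡⟨ cong (λ m → H * mass (Step? Q?) + (M ^ j + (M ^ j + m))) (sym (+-identityʳ (M ^ j))) ⟩
    H * mass (Step? Q?) + 3 * M ^ j ∎
    where
    open ≤-Reasoning
    e? : Decidable (λ l → Q l × ¬ EndRich Q? l)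
    e? l = Q? l ×-dec ¬? (EndRich? Q? l)
    a? : Decidable (λ l → Q l × ¬ PrefixRich Q? i₀ l)
    a? l = Q? l ×-dec ¬? (PrefixRich? Q? i₀ l)
    b? : Decidable (λ l → Q l × ¬ PrefixRich Q? p l)
    b? l = Q? l ×-dec ¬? (PrefixRich? Q? p l)
    distrib : ∀ m a b c d → m * (a + (b + (c + d))) ≡ m * a + (m * b + (m * c + m * d))
    distrib = solve-∀
    split : ∀ l → # (Q? l) ≤ # (Step? Q? l) + (# (e? l) + (# (a? l) + # (b? l)))
    split l with Q? l | EndRich? Q? l | PrefixRich? Q? i₀ l | PrefixRich? Q? p l
    ... | no _  | _     | _     | _     = z≤n
    ... | yes _ | no _  | _     | _     = s≤s z≤n
    ... | yes _ | yes _ | no _  | _     = s≤s z≤n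
    ... | yes _ | yes _ | yes _ | no _  = s≤s z≤n
    ... | yes _ | yes _ | yes _ | yes _ = s≤s z≤n

  -- Richness in `Layer (suc r)` refers to `Layer r`, so each exchange of a walk goes down one
  -- level. As the number of exchanges is bounded, finitely many levels replace a family that is
  -- stable under discarding.
  Layer : ℕ → List (Fin n) → Set
  Layer? : ∀ r → Decidable (Layer r)
  Layer zero    = Bad j x
  Layer (suc r) = Step (Layer? r)
  Layer? zero    = Bad? j x
  Layer? (suc r) = Step? (Layer? r)

  Layer⇒Bad : ∀ r {l} → Layer r l → Bad j x l
  Layer⇒Bad zero    b       = b
  Layer⇒Bad (suc r) (b , _) = Layer⇒Bad r b

  total-loss : ∀ r → H * mass (Layer? 0) ≤ H * mass (Layer? r) + r * (3 * M ^ j)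
  total-loss zero    = m≤m+n _ _
  total-loss (suc r) = begin
    H * mass (Layer? 0)                                            ≤⟨ total-loss r ⟩
    H * mass (Layer? r) + r * (3 * M ^ j)                          ≤⟨ +-monoˡ-≤ (r * (3 * M ^ j)) (step-loss (Layer? r)) ⟩
    H * mass (Layer? (suc r)) + 3 * M ^ j + r * (3 * M ^ j)        ≡⟨ +-assoc (H * mass (Layer? (suc r))) (3 * M ^ j) _ ⟩
    H * mass (Layer? (suc r)) + suc r * (3 * M ^ j)                ∎
    where open ≤-Reasoning

  -- Each of the `suc r` rounds loses at most `3 * M ^ j / H`. With this `H` the total loss is at
  -- most `M ^ j / E`, which is less than the initial mass.
  layer-inhabited : ∀ r E → H ≡ suc r * 3 * E → M ^ j < E * mass (Layer? 0) →
    ∃ λ l → length l ≡ j × Layer (suc r) l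
  layer-inhabited r E refl big with mass (Layer? (suc r)) in eq
  ... | suc m with ∑-pos (words j) (λ l → u x l * # (Layer? (suc r) l)) (subst (0 <_) (sym eq) (s≤s z≤n))
  ...   | l , l∈ , pos = l , ∈-words j l∈ , #-pos (Layer? (suc r) l) (*-pos⁻ʳ (u x l) pos)
  layer-inhabited r E refl big | zero = ⊥-elim (<⇒≱ big (*-cancelˡ-≤ (suc r * 3) (begin
    suc r * 3 * (E * mass (Layer? 0))                               ≡⟨ sym (*-assoc (suc r * 3) E _) ⟩
    H * mass (Layer? 0)                                             ≤⟨ total-loss (suc r) ⟩
    H * mass (Layer? (suc r)) + suc r * (3 * M ^ j)                 ≡⟨ cong (λ m → H * m + suc r * (3 * M ^ j)) eq ⟩
    H * 0 + suc r * (3 * M ^ j)                                     ≡⟨ cong (_+ suc r * (3 * M ^ j)) (*-zeroʳ H) ⟩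
    suc r * (3 * M ^ j)                                             ≡⟨ sym (*-assoc (suc r) 3 (M ^ j)) ⟩
    suc r * 3 * M ^ j                                               ∎)))
    where open ≤-Reasoning

-- Exchanging a walk for one that avoids a bounded set.

module Avoidance {n : ℕ} (G : Graph n) (d₀ X : ℕ) (x : Fin n) (p i₀ H : ℕ) (i₀≤ : i₀ ≤ suc p) where

  open Weights G
  open Walks G d₀ X
  open RichFibres G d₀ X x p i₀ H i₀≤

  occurs : List (Fin n) → Fin n → ℕ
  occurs Z v = ∑ Z (λ z → # (z ≟ v))

  ∑-occurs≤ : ∀ Z → ∑ (allFin n) (occurs Z) ≤ length Z
  ∑-occurs≤ Z = begin
    ∑ (allFin n) (occurs Z)                          ≡⟨ ∑-swap (allFin n) Z (λ v z → # (z ≟ v)) ⟩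
    ∑ Z (λ z → ∑ (allFin n) (λ v → # (z ≟ v)))       ≤⟨ ∑-mono Z (λ {z} _ → ∑-≟≤1 z) ⟩
    ∑ Z (λ _ → 1)                                    ≡⟨ trans (∑-const Z 1) (*-identityʳ (length Z)) ⟩
    length Z                                         ∎
    where open ≤-Reasoning

  ∈⇒occurs>0 : ∀ {Z v} → v ∈ Z → 1 ≤ occurs Z v
  ∈⇒occurs>0 {Z} {v} v∈ = ≤-trans (≤-reflexive (sym (#-yes (v ≟ v) refl))) (∈⇒≤∑ (λ z → # (z ≟ v)) v∈)

  abstract
    High? : Decidable High
    High? v = _ ≤? _

    avoids? : ∀ Z (d : List (Fin n)) → Dec (All (_∉ Z) d)
    avoids? Z = All.all? (λ v → ¬? (v ∈? Z))

    ∉∪∈ : ∀ Z (v : Fin n) → v ∈ Z ⊎ v ∉ Z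
    ∉∪∈ Z v with v ∈? Z
    ... | yes p = inj₁ p
    ... | no q  = inj₂ q

  -- Visits to `Z` are counted only until a vertex of small degree has to be left. This keeps
  -- `∑-hits≤` valid for all walks and loses nothing on admissible ones.
  hits : List (Fin n) → Fin n → List (Fin n) → ℕ
  hits Z e []      = 0
  hits Z e (v ∷ d) = # (High? e) * (occurs Z v + hits Z v d)

  -- A step from a vertex of degree at least `d₀` hits a given vertex with probability at most
  -- `1 / d₀`; this is summed over the `k` steps and the members of `Z`.
  ∑-hits≤ : ∀ Z k e → d₀ * ∑ (words k) (λ d → u e d * hits Z e d) ≤ k * length Z * M ^ k
  ∑-hits≤ Z zero    e = ≤-reflexive (*-zeroʳ d₀)
  ∑-hits≤ Z (suc k) e with High? e in eq
  ... | no _ = ≤-trans (≤-reflexive (trans (cong (d₀ *_) (trans (∑u-suc e k (hits Z e)) (∑-zero (allFin n) (λ {v} _ →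
                 trans (cong (q e * A e v *_) (∑-zero (words k) (λ {d} _ → trans (cong (λ h → u v d * (# h * (occurs Z v + hits Z v d))) eq) (*-zeroʳ (u v d)))))
                       (*-zeroʳ (q e * A e v)))))) (*-zeroʳ d₀))) z≤n
  ... | yes h = begin
    d₀ * ∑ (words (suc k)) (λ d → u e d * hits Z e d)
      ≡⟨ cong (d₀ *_) (trans (∑u-suc e k (hits Z e)) (∑-cong (allFin n) (λ {v} _ →
           cong (q e * A e v *_) (trans (∑-cong (words k) (λ {d} _ → trans (cong (λ h → u v d * (# h * (occurs Z v + hits Z v d))) eq)
                                             (expand (u v d) (occurs Z v) (hits Z v d))))
                                   (trans (∑-+ (words k) (λ d → occurs Z v * u v d) (λ d → u v d * hits Z v d))
                                          (cong (_+ S v) (∑-* (occurs Z v) (words k) (u v)))))))) ⟩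
    d₀ * ∑ (allFin n) (λ v → q e * A e v * (occurs Z v * ∑ (words k) (u v) + S v))
      ≡⟨ sym (∑-* d₀ (allFin n) _) ⟩
    ∑ (allFin n) (λ v → d₀ * (q e * A e v * (occurs Z v * ∑ (words k) (u v) + S v)))
      ≤⟨ ∑-mono (allFin n) (λ {v} _ → step v) ⟩
    ∑ (allFin n) (λ v → M * M ^ k * occurs Z v + q e * A e v * (k * length Z * M ^ k))
      ≡⟨ trans (∑-+ (allFin n) (λ v → M * M ^ k * occurs Z v) (λ v → q e * A e v * (k * length Z * M ^ k)))
               (cong₂ _+_ (∑-* (M * M ^ k) (allFin n) (occurs Z)) (∑-*ʳ (k * length Z * M ^ k) (allFin n) (λ v → q e * A e v))) ⟩
    M * M ^ k * ∑ (allFin n) (occurs Z) + ∑ (allFin n) (λ v → q e * A e v) * (k * length Z * M ^ k)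
      ≤⟨ +-mono-≤ (*-monoʳ-≤ (M * M ^ k) (∑-occurs≤ Z)) (*-monoˡ-≤ (k * length Z * M ^ k) (∑qA≤ e)) ⟩
    M * M ^ k * length Z + M * (k * length Z * M ^ k)
      ≡⟨ collect M (M ^ k) (length Z) k ⟩
    (length Z + k * length Z) * (M * M ^ k) ∎
    where
    open ≤-Reasoning
    S : Fin n → ℕ
    S v = ∑ (words k) (λ d → u v d * hits Z v d)
    expand : ∀ a b c → a * (1 * (b + c)) ≡ b * a + a * c
    expand = solve-∀
    collect : ∀ m p z k → m * p * z + m * (k * z * p) ≡ (z + k * z) * (m * p)
    collect = solve-∀
    regroup : ∀ d q a o s t → d * (q * a * (o * s + t)) ≡ q * d * (a * s * o) + q * a * (d * t)
    regroup = solve-∀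
    step : ∀ v → d₀ * (q e * A e v * (occurs Z v * ∑ (words k) (u v) + S v)) ≤
                 M * M ^ k * occurs Z v + q e * A e v * (k * length Z * M ^ k)
    step v = begin
      d₀ * (q e * A e v * (occurs Z v * ∑ (words k) (u v) + S v))
        ≡⟨ regroup d₀ (q e) (A e v) (occurs Z v) _ (S v) ⟩
      q e * d₀ * (A e v * ∑ (words k) (u v) * occurs Z v) + q e * A e v * (d₀ * S v)
        ≤⟨ +-mono-≤ (*-mono-≤ (q*d₀≤M h) (*-monoˡ-≤ (occurs Z v) (*-mono-≤ (A≤1 e v) (∑u≤ v k))))
                    (*-monoʳ-≤ (q e * A e v) (∑-hits≤ Z k v)) ⟩
      M * (1 * M ^ k * occurs Z v) + q e * A e v * (k * length Z * M ^ k)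
        ≡⟨ cong (_+ q e * A e v * (k * length Z * M ^ k))
             (trans (cong (λ m → M * (m * occurs Z v)) (*-identityˡ (M ^ k))) (sym (*-assoc M (M ^ k) (occurs Z v)))) ⟩
      M * M ^ k * occurs Z v + q e * A e v * (k * length Z * M ^ k) ∎

  -- Vertices move from `d` to `c` until one lies in `Z`. Every vertex left on the way ends a proper
  -- prefix, so its degree is large.
  adm-hits : ∀ Z c d → length (c ++ d) ≡ j → Adm j x (c ++ d) → ¬ All (_∉ Z) d → 1 ≤ hits Z (end x c) d
  adm-hits Z c []      _   _   ¬av = contradiction [] ¬av
  adm-hits Z c (v ∷ d) len adm ¬av with High? (end x c)
  ... | no ¬h = contradiction high ¬h
    where
    c< : length c < j
    c< = subst (length c <_) (trans (sym (length-++ c)) len) (m<m+n (length c) (s≤s z≤n))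
    high : High (end x c)
    high = subst (λ c → High (end x c)) (take-length-++ c (v ∷ d))
             (adm-end-high (length c) (trans (length-take (length c) (c ++ v ∷ d)) (m≤n⇒m⊓n≡m
                 (subst (length c ≤_) (sym (length-++ c)) (m≤m+n _ _)))) (proj₁ (adm-take j adm c<)))
  ... | yes _ with ∉∪∈ Z v
  ...   | inj₁ v∈ = ≤-trans (∈⇒occurs>0 v∈) (≤-trans (m≤m+n (occurs Z v) (hits Z v d)) (≤-reflexive (sym (*-identityˡ _))))
  ...   | inj₂ v∉ = ≤-trans (subst (λ e → 1 ≤ hits Z e d) (end-++ x c (v ∷ []))
            (adm-hits Z (c ++ v ∷ []) d (trans (cong length (++-assoc c (v ∷ []) d)) len) (subst (Adm j x) (sym (++-assoc c (v ∷ []) d)) adm)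
               (λ av → ¬av (v∉ ∷ av))))
          (≤-trans (m≤n+m (hits Z v d) (occurs Z v)) (≤-reflexive (sym (*-identityˡ _))))

  module _ {Q : List (Fin n) → Set} (Q? : Decidable Q) (Q⇒Bad : ∀ {l} → Q l → Bad j x l) where

    -- If no extension in `Q` avoided `Z`, richness would make a random extension of the prefix hit
    -- `Z` with probability at least `1 / H`, while the expected number of hits is at most
    -- `j * z₀ / d₀`.
    avoid-prefix : ∀ z₀ → H * (j * z₀) < d₀ → ∀ Z → length Z ≤ z₀ → ∀ i → i ≤ j → ∀ l → length l ≡ j →
      Q l → PrefixRich Q? i l → ∃ λ d → length d ≡ j ∸ i × Q (take i l ++ d) × All (_∉ Z) d
    avoid-prefix z₀ big Z Z≤ i i≤j l len ql rich
      with ∑ (words (j ∸ i)) (λ d → u x (take i l ++ d) * # (Q? (take i l ++ d) ×-dec avoids? Z d)) in eq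
    ... | suc m with ∑-pos (words (j ∸ i)) (λ d → u x (take i l ++ d) * # (Q? (take i l ++ d) ×-dec avoids? Z d)) (subst (0 <_) (sym eq) (s≤s z≤n))
    ...   | d , d∈ , pos = d , ∈-words (j ∸ i) d∈ , #-pos (Q? (take i l ++ d) ×-dec avoids? Z d) (*-pos⁻ʳ (u x (take i l ++ d)) pos)
    avoid-prefix z₀ big Z Z≤ i i≤j l len ql rich | zero = ⊥-elim (<⇒≱ big (*-cancelʳ-≤ d₀ (H * (j * z₀)) (M ^ k) {{m^n≢0 M k {{>-nonZero M>0}}}} (begin
      d₀ * M ^ k                              ≤⟨ *-monoʳ-≤ d₀ small ⟩
      d₀ * (H * S)                            ≡⟨ *-swapˡ d₀ H S ⟩
      H * (d₀ * S)                            ≤⟨ *-monoʳ-≤ H (∑-hits≤ Z k (end x c)) ⟩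
      H * (k * length Z * M ^ k)              ≡⟨ sym (*-assoc H (k * length Z) (M ^ k)) ⟩
      H * (k * length Z) * M ^ k              ≤⟨ *-monoˡ-≤ (M ^ k) (*-monoʳ-≤ H (*-mono-≤ (m∸n≤m j i) Z≤)) ⟩
      H * (j * z₀) * M ^ k                    ∎)))
      where
      open ≤-Reasoning
      k : ℕ
      k = j ∸ i
      c : List (Fin n)
      c = take i l
      c-len : length c ≡ i
      c-len = length-take-≤ len i≤j
      S : ℕ
      S = ∑ (words k) (λ d → u (end x c) d * hits Z (end x c) d)
      u>0 : 0 < u x c
      u>0 = *-pos⁻ˡ (u x c) (subst (0 <_) (trans (cong (u x) (sym (take++drop≡id i l))) (u-++ x c (drop i l))) (adm-u>0 j len (proj₁ (Q⇒Bad ql))))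
      pointwise : ∀ {d} → d ∈ words k → u x (c ++ d) * # (Q? (c ++ d)) ≤
        u x c * (u (end x c) d * hits Z (end x c) d) + u x (c ++ d) * # (Q? (c ++ d) ×-dec avoids? Z d)
      pointwise {d} d∈ with Q? (c ++ d) | avoids? Z d
      ... | no _   | _      = ≤-trans (≤-reflexive (*-zeroʳ (u x (c ++ d)))) z≤n
      ... | yes _  | yes _  = m≤n+m (u x (c ++ d) * 1) (u x c * (u (end x c) d * hits Z (end x c) d))
      ... | yes qd | no ¬av = ≤-trans (≤-trans (≤-reflexive (trans (cong (_* 1) (u-++ x c d)) (*-assoc (u x c) (u (end x c) d) 1)))
            (*-monoʳ-≤ (u x c) (*-monoʳ-≤ (u (end x c) d) (adm-hits Z c d cd-len (proj₁ (Q⇒Bad qd)) ¬av)))) (m≤m+n _ _)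
        where
        cd-len : length (c ++ d) ≡ j
        cd-len = trans (length-++ c) (trans (cong₂ _+_ c-len (∈-words k d∈)) (m+[n∸m]≡n i≤j))
      -- The prefix weight `u x c` is a factor of every extension and cancels.
      small : M ^ k ≤ H * S
      small = *-cancelʳ-≤ (M ^ k) (H * S) (u x c) {{>-nonZero u>0}} (begin
        M ^ k * u x c
          ≤⟨ rich ⟩
        H * ∑ (words k) (λ d → u x (c ++ d) * # (Q? (c ++ d)))
          ≤⟨ *-monoʳ-≤ H (∑-mono (words k) pointwise) ⟩
        H * ∑ (words k) (λ d → u x c * (u (end x c) d * hits Z (end x c) d) + u x (c ++ d) * # (Q? (c ++ d) ×-dec avoids? Z d))
          ≡⟨ cong (H *_) (trans (∑-+ (words k) (λ d → u x c * (u (end x c) d * hits Z (end x c) d)) (λ d → u x (c ++ d) * # (Q? (c ++ d) ×-dec avoids? Z d)))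
               (trans (cong₂ _+_ (∑-* (u x c) (words k) (λ d → u (end x c) d * hits Z (end x c) d)) eq) (+-identityʳ _))) ⟩
        H * (u x c * S)
          ≡⟨ trans (cong (H *_) (*-comm (u x c) S)) (sym (*-assoc H S (u x c))) ⟩
        H * S * u x c ∎)

    -- Positions 1 to `p` only: the start and the end are shared by all walks of a fibre.
    visits : List (Fin n) → List (Fin n) → ℕ
    visits Z l = ∑ (upTo p) (λ i → occurs Z (end x (take (suc i) l)))

    Clear : List (Fin n) → List (Fin n) → Set
    Clear Z l = All (λ i → end x (take (suc i) l) ∉ Z) (upTo p)

    abstract
      clear? : ∀ Z l → Dec (Clear Z l)
      clear? Z l = All.all? (λ i → ¬? (end x (take (suc i) l) ∈? Z)) (upTo p)

    not-clear : ∀ Z l → ¬ Clear Z l → 1 ≤ visits Z l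
    not-clear Z l ¬cl = go (upTo p) ¬cl
      where
      go : ∀ is → ¬ All (λ i → end x (take (suc i) l) ∉ Z) is → 1 ≤ ∑ is (λ i → occurs Z (end x (take (suc i) l)))
      go []       ¬a = contradiction [] ¬a
      go (i ∷ is) ¬a with ∉∪∈ Z (end x (take (suc i) l))
      ... | inj₁ ∈Z = ≤-trans (∈⇒occurs>0 ∈Z) (m≤m+n _ _)
      ... | inj₂ ∉Z = ≤-trans (go is (λ a → ¬a (∉Z ∷ a))) (m≤n+m _ _)

    -- Cutting at position `suc m` gives okay walks from `x` to `z` and from `z` to `y`, and the two
    -- pieces determine the walk.
    through : ∀ m m′ → j ≡ suc m + suc m′ → ∀ z y →
      ∑ (words j) (λ l → # (end x l ≟ y) * # (Q? l) * # (z ≟ end x (take (suc m) l))) ≤ D (suc m) * D (suc m′)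
    through m m′ j≡ z y = begin
      ∑ (words j) (λ l → # (end x l ≟ y) * # (Q? l) * # (z ≟ end x (take (suc m) l)))
        ≡⟨ cong (λ k → ∑ (words k) (λ l → # (end x l ≟ y) * # (Q? l) * # (z ≟ end x (take (suc m) l)))) j≡ ⟩
      ∑ (words (suc m + suc m′)) (λ l → # (end x l ≟ y) * # (Q? l) * # (z ≟ end x (take (suc m) l)))
        ≡⟨ ∑-words-+ (suc m) (suc m′) (λ l → # (end x l ≟ y) * # (Q? l) * # (z ≟ end x (take (suc m) l))) ⟩
      ∑ (words (suc m)) (λ a → ∑ (words (suc m′)) (λ b → # (end x (a ++ b) ≟ y) * # (Q? (a ++ b)) * # (z ≟ end x (take (suc m) (a ++ b)))))
        ≤⟨ ∑-mono (words (suc m)) (λ {a} a∈ → ∑-mono (words (suc m′)) (λ {b} _ → pointwise a b (∈-words (suc m) a∈))) ⟩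
      ∑ (words (suc m)) (λ a → ∑ (words (suc m′)) (λ b → f a * g b))
        ≡⟨ trans (∑-cong (words (suc m)) (λ {a} _ → ∑-* (f a) (words (suc m′)) g)) (∑-*ʳ (∑ (words (suc m′)) g) (words (suc m)) f) ⟩
      ∑ (words (suc m)) f * ∑ (words (suc m′)) g
        ≤⟨ *-mono-≤ (count-okay (suc m) x z) (count-okay (suc m′) z y) ⟩
      D (suc m) * D (suc m′) ∎
      where
      open ≤-Reasoning
      f g : List (Fin n) → ℕ
      f a = # (end x a ≟ z) * # (Okay? (suc m) x a)
      g b = # (end z b ≟ y) * # (Okay? (suc m′) z b)
      okays : ∀ a b → length a ≡ suc m → Adm j x (a ++ b) → Okay (suc m) x a × Okay (suc m′) (end x a) b
      okays (v ∷ a) b la adm =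
        subst (λ k → Okay k x (v ∷ a)) la (subst (Okay (length (v ∷ a)) x) (take-length-++ (v ∷ a) b)
          (adm-take j adm (subst (length (v ∷ a) <_) (sym j≡′) (m<m+n (length (v ∷ a)) (s≤s z≤n))))) ,
        adm-drop (suc m′) a (subst (λ k → Adm k x (v ∷ a ++ b)) j≡′ adm)
        where
        j≡′ : j ≡ suc (length a + suc m′)
        j≡′ = trans j≡ (cong (_+ suc m′) (sym la))
      pointwise : ∀ a b → length a ≡ suc m →
        # (end x (a ++ b) ≟ y) * # (Q? (a ++ b)) * # (z ≟ end x (take (suc m) (a ++ b))) ≤ f a * g b
      pointwise a b la with end x (a ++ b) ≟ y | Q? (a ++ b) | z ≟ end x (take (suc m) (a ++ b))
      ... | no _  | _     | _    = z≤n
      ... | yes _ | no _  | _    = z≤n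
      ... | yes _ | yes _ | no _ = z≤n
      ... | yes y≡ | yes qab | yes z≡ with trans z≡ (cong (end x) (trans (cong (λ k → take k (a ++ b)) (sym la)) (take-length-++ a b)))
      ...   | refl = ≤-reflexive (sym (cong₂ _*_
                (cong₂ _*_ (#-yes (end x a ≟ end x a) refl) (#-yes (Okay? (suc m) x a) (proj₁ ok)))
                (cong₂ _*_ (#-yes (end (end x a) b ≟ y) (trans (sym (end-++ x a b)) y≡)) (#-yes (Okay? (suc m′) (end x a) b) (proj₂ ok)))))
        where
        ok : Okay (suc m) x a × Okay (suc m′) (end x a) b
        ok = okays a b la (proj₁ (Q⇒Bad qab))

    X*D*D≡D : ∀ m m′ → X * (D (suc m) * D (suc m′)) ≡ D (suc m + suc m′)
    X*D*D≡D m m′ = trans (cong (X *_) (sym (^-distribˡ-+-* X (suc (2 * m)) (suc (2 * m′)))))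
                         (cong (X ^_) (exponents m m′))
      where
      exponents : ∀ m m′ → 1 + ((1 + 2 * m) + (1 + 2 * m′)) ≡ 1 + 2 * (m + (1 + m′))
      exponents = solve-∀

    -- For each position and each member of `Z` there are at most `D j / X` walks, by `through` and
    -- the choice of exponents in `D`.
    ∑-visits≤ : ∀ Z y → X * ∑ (words j) (λ l → # (end x l ≟ y) * # (Q? l) * visits Z l) ≤ p * length Z * D j
    ∑-visits≤ Z y = begin
      X * ∑ (words j) (λ l → F l * visits Z l)
        ≡⟨ cong (X *_) (trans (∑-cong (words j) (λ {l} _ → sym (∑-* (F l) (upTo p) (λ i → occurs Z (end x (take (suc i) l))))))
             (∑-swap (words j) (upTo p) (λ l i → F l * occurs Z (end x (take (suc i) l))))) ⟩
      X * ∑ (upTo p) (λ i → ∑ (words j) (λ l → F l * occurs Z (end x (take (suc i) l))))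
        ≡⟨ sym (∑-* X (upTo p) (λ i → ∑ (words j) (λ l → F l * occurs Z (end x (take (suc i) l))))) ⟩
      ∑ (upTo p) (λ i → X * ∑ (words j) (λ l → F l * occurs Z (end x (take (suc i) l))))
        ≤⟨ ∑-mono (upTo p) (λ {i} i∈ → position i (∈-upTo⁻ i∈)) ⟩
      ∑ (upTo p) (λ _ → length Z * D j)
        ≡⟨ trans (∑-const (upTo p) (length Z * D j)) (cong (_* (length Z * D j)) (length-upTo p)) ⟩
      p * (length Z * D j)
        ≡⟨ sym (*-assoc p (length Z) (D j)) ⟩
      p * length Z * D j ∎
      where
      open ≤-Reasoning
      F : List (Fin n) → ℕ
      F l = # (end x l ≟ y) * # (Q? l)
      position : ∀ i → i < p → X * ∑ (words j) (λ l → F l * occurs Z (end x (take (suc i) l))) ≤ length Z * D j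
      position i i<p = begin
        X * ∑ (words j) (λ l → F l * occurs Z (end x (take (suc i) l)))
          ≡⟨ cong (X *_) (trans (∑-cong (words j) (λ {l} _ → sym (∑-* (F l) Z (λ z → # (z ≟ end x (take (suc i) l))))))
               (∑-swap (words j) Z (λ l z → F l * # (z ≟ end x (take (suc i) l))))) ⟩
        X * ∑ Z (λ z → ∑ (words j) (λ l → F l * # (z ≟ end x (take (suc i) l))))
          ≡⟨ sym (∑-* X Z (λ z → ∑ (words j) (λ l → F l * # (z ≟ end x (take (suc i) l))))) ⟩
        ∑ Z (λ z → X * ∑ (words j) (λ l → F l * # (z ≟ end x (take (suc i) l))))
          ≤⟨ ∑-mono Z (λ {z} _ → ≤-trans (*-monoʳ-≤ X (through i m′ j≡ z y))
               (≤-reflexive (trans (X*D*D≡D i m′) (cong D (sym j≡))))) ⟩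
        ∑ Z (λ _ → D j)
          ≡⟨ ∑-const Z (D j) ⟩
        length Z * D j ∎
        where
        m′ : ℕ
        m′ = p ∸ suc i
        j≡ : j ≡ suc i + suc m′
        j≡ = cong suc (trans (sym (m+[n∸m]≡n i<p)) (sym (+-suc i m′)))

    -- The members of `Q` with this end together have at least `1 / H` of the weight `w`, and each,
    -- being bad, has less than `w / D j`. So there are more than `D j / H` of them, whereas at most
    -- `p * z₀ * D j / X` meet `Z` in their interior.
    avoid-end : ∀ z₀ → H * (j * z₀) < X → ∀ Z → length Z ≤ z₀ → ∀ l → length l ≡ j →
      Q l → EndRich Q? l → ∃ λ l′ → length l′ ≡ j × Q l′ × end x l′ ≡ end x l × Clear Z l′
    avoid-end z₀ big Z Z≤ l len ql rich
      with ∑ (words j) (λ l′ → # (end x l′ ≟ end x l) * # (Q? l′ ×-dec clear? Z l′)) in eq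
    ... | suc m with ∑-pos (words j) (λ l′ → # (end x l′ ≟ end x l) * # (Q? l′ ×-dec clear? Z l′)) (subst (0 <_) (sym eq) (s≤s z≤n))
    ...   | l′ , l′∈ , pos with #-pos (Q? l′ ×-dec clear? Z l′) (*-pos⁻ʳ (# (end x l′ ≟ end x l)) pos)
    ...     | ql′ , cl = l′ , ∈-words j l′∈ , ql′ , #-pos (end x l′ ≟ end x l) (*-pos⁻ˡ _ pos) , cl
    avoid-end z₀ big Z Z≤ l len ql rich | zero = ⊥-elim (<⇒≱ big (*-cancelʳ-≤ X (H * (j * z₀)) (D j)
      {{m^n≢0 X (suc (2 * p)) {{>-nonZero (≤-trans (s≤s z≤n) big)}}}} (begin
      X * D j                         ≤⟨ *-monoʳ-≤ X small ⟩
      X * (H * S)                     ≡⟨ *-swapˡ X H S ⟩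
      H * (X * S)                     ≤⟨ *-monoʳ-≤ H (∑-visits≤ Z y) ⟩
      H * (p * length Z * D j)        ≡⟨ sym (*-assoc H (p * length Z) (D j)) ⟩
      H * (p * length Z) * D j        ≤⟨ *-monoˡ-≤ (D j) (*-monoʳ-≤ H (*-mono-≤ (n≤1+n p) Z≤)) ⟩
      H * (j * z₀) * D j              ∎)))
      where
      open ≤-Reasoning
      y : Fin n
      y = end x l
      w S : ℕ
      w = W j x y
      S = ∑ (words j) (λ l′ → # (end x l′ ≟ y) * # (Q? l′) * visits Z l′)
      bad-weight : ∀ {l′} → length l′ ≡ j → Q l′ → D j * u x l′ < W j x (end x l′)
      bad-weight {l′} len′ ql′ = subst (λ k → D k * u x l′ < W k x (end x l′)) len′ (≰⇒> (proj₂ (Q⇒Bad ql′)))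
      w>0 : 0 < w
      w>0 = ≤-trans (s≤s z≤n) (bad-weight len ql)
      pointwise : ∀ {l′} → l′ ∈ words j → D j * (# (end x l′ ≟ y) * u x l′ * # (Q? l′)) ≤
        w * (# (end x l′ ≟ y) * # (Q? l′) * visits Z l′ + # (end x l′ ≟ y) * # (Q? l′ ×-dec clear? Z l′))
      pointwise {l′} l′∈ with end x l′ ≟ y | Q? l′ | clear? Z l′
      ... | no _   | _      | _     = ≤-trans (≤-reflexive (*-zeroʳ (D j))) z≤n
      ... | yes _  | no _   | _     = ≤-trans (≤-reflexive (trans (cong (D j *_) (*-zeroʳ (1 * u x l′))) (*-zeroʳ (D j)))) z≤n
      ... | yes y≡ | yes qd | c? = begin
        D j * (1 * u x l′ * 1)                         ≡⟨ cong (D j *_) (trans (*-identityʳ _) (*-identityˡ _)) ⟩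
        D j * u x l′                                   ≤⟨ <⇒≤ (subst (λ e → D j * u x l′ < W j x e) y≡ (bad-weight (∈-words j l′∈) qd)) ⟩
        w                                              ≡⟨ sym (*-identityʳ w) ⟩
        w * 1                                          ≤⟨ *-monoʳ-≤ w (one c?) ⟩
        w * (1 * visits Z l′ + 1 * # (yes qd ×-dec c?)) ∎
        where
        one : ∀ (c? : Dec (Clear Z l′)) → 1 ≤ 1 * visits Z l′ + 1 * # (yes qd ×-dec c?)
        one (yes _)  = m≤n+m 1 (1 * visits Z l′)
        one (no ¬cl) = ≤-trans (not-clear Z l′ ¬cl) (≤-trans (≤-reflexive (sym (*-identityˡ _))) (m≤m+n _ _))
      -- No member of `Q` with end `y` is clear, so `S` counts each of them at least once.
      small : D j ≤ H * S
      small = *-cancelʳ-≤ (D j) (H * S) w {{>-nonZero w>0}} (begin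
        D j * w
          ≤⟨ *-monoʳ-≤ (D j) rich ⟩
        D j * (H * ∑ (words j) (λ l′ → # (end x l′ ≟ y) * u x l′ * # (Q? l′)))
          ≡⟨ trans (*-swapˡ (D j) H _) (cong (H *_) (sym (∑-* (D j) (words j) (λ l′ → # (end x l′ ≟ y) * u x l′ * # (Q? l′))))) ⟩
        H * ∑ (words j) (λ l′ → D j * (# (end x l′ ≟ y) * u x l′ * # (Q? l′)))
          ≤⟨ *-monoʳ-≤ H (∑-mono (words j) pointwise) ⟩
        H * ∑ (words j) (λ l′ → w * (# (end x l′ ≟ y) * # (Q? l′) * visits Z l′ + # (end x l′ ≟ y) * # (Q? l′ ×-dec clear? Z l′)))
          ≡⟨ cong (H *_) (trans (∑-* w (words j) (λ l′ → # (end x l′ ≟ y) * # (Q? l′) * visits Z l′ + # (end x l′ ≟ y) * # (Q? l′ ×-dec clear? Z l′)))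
               (cong (w *_) (trans (∑-+ (words j) (λ l′ → # (end x l′ ≟ y) * # (Q? l′) * visits Z l′) (λ l′ → # (end x l′ ≟ y) * # (Q? l′ ×-dec clear? Z l′)))
                 (trans (cong (S +_) eq) (+-identityʳ S))))) ⟩
        H * (w * S)
          ≡⟨ trans (cong (H *_) (*-comm w S)) (sym (*-assoc H S w)) ⟩
        H * S * w ∎)

-- Paths from a walk back to its start.

all-reverse : {A : Set} {P : A → Set} {c : List A} → All P c → All P (reverse c)
all-reverse []               = []
all-reverse {P = P} {v ∷ c} (p ∷ ps) =
  subst (All P) (sym (unfold-reverse v c)) (Allₚ.++⁺ (all-reverse ps) (p ∷ []))

unique-reverse : {A : Set} {c : List A} → Unique c → Unique (reverse c)
unique-reverse []                = []
unique-reverse {c = v ∷ c} (v∉ ∷ u) =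
  subst Unique (sym (unfold-reverse v c))
    (++⁺ (unique-reverse u) ([] ∷ []) (λ { (w∈ , here refl) → All.lookup (all-reverse v∉) w∈ refl }))

unique-∷ʳ⁻ : {A : Set} (c : List A) {y : A} → Unique (c ++ y ∷ []) → Unique c × y ∉ c
unique-∷ʳ⁻ []      _        = [] , λ ()
unique-∷ʳ⁻ (v ∷ c) (v∉ ∷ u) with unique-∷ʳ⁻ c u
... | uc , y∉ = Allₚ.++⁻ˡ c v∉ ∷ uc , λ { (here refl) → All.head (Allₚ.++⁻ʳ c v∉) refl ; (there y∈) → y∉ y∈ }

take-end : ∀ {n} p (x : Fin n) l → length l ≡ suc p → take p l ++ end x l ∷ [] ≡ l
take-end zero    x (v ∷ [])    _   = refl
take-end (suc p) x (v ∷ w ∷ l) len = cong (v ∷_) (take-end p v (w ∷ l) (suc-injective len))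

module Paths {n : ℕ} (G : Graph n) where

  Walk : Fin n → List (Fin n) → Set
  Walk e []      = ⊤
  Walk e (v ∷ d) = adj G e v ≡ true × Walk v d

  -- c lists the internal vertices of a walk from e to y.
  Path : Fin n → List (Fin n) → Fin n → Set
  Path e []      y = adj G e y ≡ true
  Path e (v ∷ c) y = adj G e v ≡ true × Path v c y

  adj-sym : ∀ {v w} → adj G v w ≡ true → adj G w v ≡ true
  adj-sym {v} {w} e = trans (Graph.sym G w v) e

  walk-path : ∀ {e} d {c y} → Walk e d → Path (end e d) c y → Path e (d ++ c) y
  walk-path []      _       π = π
  walk-path (v ∷ d) (a , w) π = a , walk-path d w π

  walk-++⁻ʳ : ∀ {e} c {d} → Walk e (c ++ d) → Walk (end e c) d
  walk-++⁻ʳ []      w       = w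
  walk-++⁻ʳ (v ∷ c) (_ , w) = walk-++⁻ʳ c w

  walk-take : ∀ {e} i l → Walk e l → Walk e (take i l)
  walk-take zero    l       _       = tt
  walk-take (suc i) []      _       = tt
  walk-take (suc i) (v ∷ l) (a , w) = a , walk-take i l w

  walk⇒path : ∀ p {e} l → length l ≡ suc p → Walk e l → Path e (take p l) (end e l)
  walk⇒path zero    (v ∷ []) _   (a , _) = a
  walk⇒path (suc p) (v ∷ l)  len (a , w) = a , walk⇒path p l (suc-injective len) w

  path-snoc : ∀ {e} c {v y} → Path e c v → adj G v y ≡ true → Path e (c ++ v ∷ []) y
  path-snoc []      a       b = a , b
  path-snoc (w ∷ c) (a , π) b = a , path-snoc c π b

  path-reverse : ∀ {e} c {y} → Path e c y → Path y (reverse c) e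
  path-reverse []      a       = adj-sym a
  path-reverse (v ∷ c) (a , π) = subst (λ r → Path _ r _) (sym (unfold-reverse v c)) (path-snoc (reverse c) (path-reverse c π) (adj-sym a))

module Zigzag {n : ℕ} (G : Graph n) (d₀ X : ℕ) (x : Fin n) (p i₀ H : ℕ) (i₀≤ : i₀ ≤ suc p)
              (z₀ : ℕ) (H<d₀ : H * (suc p * z₀) < d₀) (H<X : H * (suc p * z₀) < X) (p>0 : 0 < p) where

  open Weights G
  open Walks G d₀ X
  open Paths G
  open RichFibres G d₀ X x p i₀ H i₀≤
  open Avoidance G d₀ X x p i₀ H i₀≤

  adm-walk : ∀ k {x l} → length l ≡ k → Adm k x l → Walk x l
  adm-walk zero    {l = []}    _   _               = tt
  adm-walk (suc k) {l = _ ∷ _} len (a , (w , _) , _) = a , adm-walk k (suc-injective len) w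

  layer-walk : ∀ r {l} → length l ≡ j → Layer r l → Walk x l
  layer-walk r len ly = adm-walk j len (proj₁ (Layer⇒Bad r ly))

  layer-unique : ∀ r {l} → length l ≡ j → Layer r l → Unique (x ∷ l)
  layer-unique r len ly = adm-unique j len (proj₁ (Layer⇒Bad r ly))

  interior-avoids : ∀ {Z} l → length l ≡ j → All (λ i → end x (take (suc i) l) ∉ Z) (upTo p) → All (_∉ Z) (take p l)
  interior-avoids {Z} l len cl = all-ends x (take p l) (λ i i< →
    let i<p = ≤-trans i< (≤-trans (≤-reflexive (length-take p l)) (m⊓n≤m p (length l)))
    in subst (λ c → end x c ∉ Z) (sym (take-take-≤ i<p l)) (All.lookup cl (∈-upTo⁺ i<p)))

  interior-unique : ∀ r l → length l ≡ j → Layer r l → Unique (take p l)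
  interior-unique r l len ly with layer-unique r len ly
  ... | _ ∷ ul = take⁺ p ul

  -- For `p = 0` the vertex in question would be the start `x`, which `cl` does not control; hence
  -- the use of `p>0`.
  last-interior : ∀ {Z} l → All (λ i → end x (take (suc i) l) ∉ Z) (upTo p) → end x (take p l) ∉ Z
  last-interior {Z} l cl = subst (λ i → end x (take i l) ∉ Z) (m+[n∸m]≡n p>0) (All.lookup cl (∈-upTo⁺ (≤-reflexive (m+[n∸m]≡n p>0))))

  -- Exchange `l` for a walk with the same end, step back to its last interior vertex `v`, and
  -- exchange only the vertex after `v` for a new one, `e`. This adds two edges and costs two layers
  -- and two forbidden vertices. After `t` rounds a last exchange with fixed end gives a walk that
  -- is followed backwards to `x`.
  zigzag : ∀ t Z → length Z + (t + t) ≤ z₀ → ∀ l → length l ≡ j → Layer (suc (t + t)) l →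
    ∃ λ c → length c ≡ p + (t + t) × Path (end x l) c x × Unique c × All (_∉ Z) c
  zigzag zero Z Z≤ l len ly
    with avoid-end (Layer? 0) id z₀ H<X Z (≤-trans (m≤m+n _ _) Z≤) l len (proj₁ ly) (proj₁ (proj₂ ly))
  ... | l′ , len′ , ly′ , end≡ , cl =
    reverse (take p l′) ,
    trans (length-reverse (take p l′)) (trans (length-take-≤ len′ (n≤1+n p)) (sym (+-identityʳ p))) ,
    subst (λ e → Path e (reverse (take p l′)) x) end≡ (path-reverse (take p l′) (walk⇒path p l′ len′ (layer-walk 0 len′ ly′))) ,
    unique-reverse (interior-unique 0 l′ len′ ly′) ,
    all-reverse (interior-avoids l′ len′ cl)
  zigzag (suc t) Z Z≤ l len ly
    with avoid-end (Layer? (suc t + suc t)) (Layer⇒Bad (suc t + suc t)) z₀ H<X Z (≤-trans (m≤m+n _ _) Z≤) l len (proj₁ ly) (proj₁ (proj₂ ly))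
  ... | l′ , len′ , ly′ , end≡ , cl
    with avoid-prefix (Layer? (t + suc t)) (Layer⇒Bad (t + suc t)) z₀ H<d₀ (end x (take p l′) ∷ Z)
           (≤-trans (≤-trans (s≤s (m≤m+n (length Z) _)) (≤-reflexive (sym (+-suc (length Z) (t + suc t))))) Z≤)
           p (n≤1+n p) l′ len′ (proj₁ ly′) (proj₂ (proj₂ (proj₂ ly′)))
  -- Beyond the prefix of length `p` a walk of length `suc p` has exactly one vertex, so `d` is a
  -- singleton.
  ... | [] , d-len , _ = ⊥-elim (0≢1+n (trans d-len (m+n∸n≡m 1 p)))
  ... | _ ∷ _ ∷ _ , d-len , _ = ⊥-elim (0≢1+n (sym (suc-injective (trans d-len (m+n∸n≡m 1 p)))))
  ... | e ∷ [] , d-len , ly″ , (e∉ ∷ [])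
    with zigzag t (e ∷ end x (take p l′) ∷ Z) (≤-trans (≤-reflexive (budget (length Z) t)) Z≤) (take p l′ ++ e ∷ [])
           (length-take-++ l′ len′ (n≤1+n p) d-len) (subst (λ r → Layer r (take p l′ ++ e ∷ [])) (+-suc t t) ly″)
    where
    budget : ∀ z t → 2 + z + (t + t) ≡ z + ((1 + t) + (1 + t))
    budget = solve-∀
  ... | c , c-len , π , uc , c∉ =
    v ∷ e ∷ c ,
    trans (cong (2 +_) c-len) (rearrange p t) ,
    (back , (forth , subst (λ w → Path w c x) (end-++ x (take p l′) (e ∷ [])) π)) ,
    (((λ v≡e → e∉ (here (sym v≡e))) ∷ All.map (λ w∉ v≡w → w∉ (there (here (sym v≡w)))) c∉)
      ∷ (All.map (λ w∉ e≡w → w∉ (here (sym e≡w))) c∉ ∷ uc)) ,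
    (last-interior l′ cl ∷ (λ e∈ → e∉ (there e∈)) ∷ All.map (λ w∉ w∈ → w∉ (there (there w∈))) c∉)
    where
    v : Fin n
    v = end x (take p l′)
    rearrange : ∀ p t → 2 + (p + (t + t)) ≡ p + ((1 + t) + (1 + t))
    rearrange = solve-∀
    back : adj G (end x l) v ≡ true
    back = subst (λ w → adj G w v ≡ true) end≡ (adj-sym (proj₁ (walk-++⁻ʳ (take p l′) {end x l′ ∷ []}
             (subst (Walk x) (sym (take-end p x l′ len′)) (layer-walk (suc t + suc t) len′ ly′)))))
    forth : adj G v e ≡ true
    forth = proj₁ (walk-++⁻ʳ {x} (take p l′) {e ∷ []} (layer-walk (t + suc t) (length-take-++ l′ len′ (n≤1+n p) d-len) ly″))

  -- A fresh continuation `d` leads from the branching vertex to the last layer, and `zigzag`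
  -- returns to `x` with `d` forbidden. With `p = j - 1` the path has length `(j ∸ i₀) + j + 2 * t`.
  link : ∀ t Z → length Z + ((j ∸ i₀) + (t + t)) ≤ z₀ → ∀ l → length l ≡ j → Layer (suc (suc (t + t))) l →
    ∃ λ c → length c ≡ (j ∸ i₀) + (p + (t + t)) × Path (end x (take i₀ l)) c x × Unique c × All (_∉ Z) c
  link t Z Z≤ l len ly
    with avoid-prefix (Layer? (suc (t + t))) (Layer⇒Bad (suc (t + t))) z₀ H<d₀ Z (≤-trans (m≤m+n _ _) Z≤)
           i₀ i₀≤ l len (proj₁ ly) (proj₁ (proj₂ (proj₂ ly)))
  ... | d , d-len , ly′ , d∉
    with zigzag t (d ++ Z) (≤-trans (≤-reflexive (trans (cong (_+ (t + t)) (trans (length-++ d) (cong (_+ length Z) d-len)))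
                               (budget (j ∸ i₀) (length Z) (t + t)))) Z≤) (take i₀ l ++ d) (length-take-++ l len i₀≤ d-len) ly′
    where
    budget : ∀ a z t → a + z + t ≡ z + (a + t)
    budget = solve-∀
  ... | c , c-len , π , uc , c∉ =
    d ++ c ,
    trans (length-++ d) (cong₂ _+_ d-len c-len) ,
    walk-path d (walk-++⁻ʳ (take i₀ l) (layer-walk (suc (t + t)) len′ ly′)) (subst (λ e → Path e c x) (end-++ x (take i₀ l) d) π) ,
    ++⁺ ud uc (λ (w∈d , w∈c) → All.lookup c∉ w∈c (∈-++⁺ˡ w∈d)) ,
    Allₚ.++⁺ d∉ (All.map (λ w∉ w∈ → w∉ (∈-++⁺ʳ d w∈)) c∉)
    where
    len′ : length (take i₀ l ++ d) ≡ j
    len′ = length-take-++ l len i₀≤ d-len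
    ud : Unique d
    ud = subst Unique (drop-length-++ (x ∷ take i₀ l) d) (drop⁺ (length (x ∷ take i₀ l)) (layer-unique (suc (t + t)) len′ ly′))

  layer-mono : ∀ {r r′} → r ≤ r′ → ∀ {l} → Layer r′ l → Layer r l
  layer-mono {r} {zero}   z≤n ly = ly
  layer-mono {r} {suc r′} r≤  ly with m≤n⇒m<n∨m≡n r≤
  ... | inj₁ (s≤s r≤r′) = layer-mono r≤r′ (proj₁ ly)
  ... | inj₂ refl       = ly

-- Theta graphs from internally disjoint paths.

module Theta {n : ℕ} (G : Graph n) where

  open Paths G

  -- Past the list the value stays `b`, in agreement with `pathVertex`, which gives `pole₂` at every
  -- positive index from `k i` on.
  along : Fin n → List (Fin n) → Fin n → ℕ → Fin n
  along a c       b zero    = a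
  along a []      b (suc m) = b
  along a (v ∷ c) b (suc m) = along v c b m

  along-adj : ∀ {a} c {b} → Path a c b → ∀ m → m ≤ length c → adj G (along a c b m) (along a c b (suc m)) ≡ true
  along-adj []      π       zero    _       = π
  along-adj (v ∷ c) (e , _) zero    _       = e
  along-adj (v ∷ c) (_ , π) (suc m) (s≤s h) = along-adj c π m h

  along-last : ∀ {a} c {b} m → length c ≤ m → along a c b (suc m) ≡ b
  along-last []      m       _       = refl
  along-last (v ∷ c) (suc m) (s≤s h) = along-last c m h

  along-∈ : ∀ {a} c {b} m → m < length c → along a c b (suc m) ∈ c
  along-∈ (v ∷ c) zero    _       = here refl
  along-∈ (v ∷ c) (suc m) (s≤s h) = there (along-∈ c m h)

  along-injective : ∀ {a} c {b} → Unique c → ∀ m m′ → m < length c → m′ < length c →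
    along a c b (suc m) ≡ along a c b (suc m′) → m ≡ m′
  along-injective (v ∷ c) _        zero    zero     _       _        _  = refl
  along-injective (v ∷ c) (v∉ ∷ _) zero    (suc m′) _       (s≤s h′) eq = ⊥-elim (All.lookup v∉ (along-∈ c m′ h′) eq)
  along-injective (v ∷ c) (v∉ ∷ _) (suc m) zero     (s≤s h) _        eq = ⊥-elim (All.lookup v∉ (along-∈ c m h) (sym eq))
  along-injective (v ∷ c) (_ ∷ u)  (suc m) (suc m′) (s≤s h) (s≤s h′) eq = cong suc (along-injective c u m m′ h h′ eq)

  paths⇒theta : ∀ {ℓ} (k : Fin ℓ → ℕ) (a b : Fin n) → a ≢ b → (c : Fin ℓ → List (Fin n)) →
    (∀ i → suc (length (c i)) ≡ k i) → (∀ i → Path a (c i) b) → (∀ i → Unique (c i)) →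
    (∀ i → a ∉ c i) → (∀ i → b ∉ c i) → (∀ i i′ → i ≢ i′ → ∀ {v} → v ∈ c i → v ∉ c i′) →
    ContainsTheta ℓ k G
  paths⇒theta {ℓ} k a b a≢b c lens paths uniq a∉ b∉ disjoint = f , injective , edges
    where
    f : ThetaV ℓ k → Fin n
    f pole₁         = a
    f pole₂         = b
    f (inner i m _) = along a (c i) b (suc m)

    m< : ∀ i {m} → suc m < k i → m < length (c i)
    m< i h = s≤s⁻¹ (subst (_ <_) (sym (lens i)) h)

    f-inner-∈ : ∀ i m h → f (inner i m h) ∈ c i
    f-inner-∈ i m h = along-∈ (c i) m (m< i h)

    same-path : ∀ i m h m′ h′ → m ≡ m′ → inner {k = k} i m h ≡ inner i m′ h′
    same-path i m h .m h′ refl = cong (inner i m) (≤-irrelevant h h′)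

    injective : ∀ {v w} → f v ≡ f w → v ≡ w
    injective {pole₁}       {pole₁}         _  = refl
    injective {pole₂}       {pole₂}         _  = refl
    injective {pole₁}       {pole₂}         eq = ⊥-elim (a≢b eq)
    injective {pole₂}       {pole₁}         eq = ⊥-elim (a≢b (sym eq))
    injective {pole₁}       {inner i m h}   eq = ⊥-elim (a∉ i (subst (_∈ c i) (sym eq) (f-inner-∈ i m h)))
    injective {pole₂}       {inner i m h}   eq = ⊥-elim (b∉ i (subst (_∈ c i) (sym eq) (f-inner-∈ i m h)))
    injective {inner i m h} {pole₁}         eq = ⊥-elim (a∉ i (subst (_∈ c i) eq (f-inner-∈ i m h)))
    injective {inner i m h} {pole₂}         eq = ⊥-elim (b∉ i (subst (_∈ c i) eq (f-inner-∈ i m h)))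
    injective {inner i m h} {inner i′ m′ h′} eq with i ≟ i′
    ... | yes refl = same-path i m h m′ h′ (along-injective (c i) (uniq i) m m′ (m< i h) (m< i h′) eq)
    ... | no i≢i′  = ⊥-elim (disjoint i i′ i≢i′ (f-inner-∈ i m h) (subst (_∈ c i′) (sym eq) (f-inner-∈ i′ m′ h′)))

    f-path : ∀ i m → f (pathVertex k i m) ≡ along a (c i) b m
    f-path i zero = refl
    f-path i (suc m) with suc m <? k i
    ... | yes _ = refl
    ... | no h  = sym (along-last (c i) m (≤-pred (subst (_≤ suc m) (sym (lens i)) (≮⇒≥ h))))

    edges : ∀ i m → m < k i → adj G (f (pathVertex k i m)) (f (pathVertex k i (suc m))) ≡ true
    edges i m h = subst₂ (λ v w → adj G v w ≡ true) (sym (f-path i m)) (sym (f-path i (suc m)))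
      (along-adj (c i) (paths i) m (≤-pred (subst (suc m ≤_) (sym (lens i)) h)))

-- Greedy choice: each list found joins the forbidden vertices, and `ℓ * L` reserves room for all of
-- them.
choose-disjoint : ∀ {n} {ℓ} (P : Fin ℓ → List (Fin n) → Set) (L z₀ : ℕ) →
  (∀ i Z → length Z ≤ z₀ → ∃ λ c → P i c × length c ≤ L × All (_∉ Z) c) →
  ∀ Z → length Z + ℓ * L ≤ z₀ →
  ∃ λ (c : Fin ℓ → List (Fin n)) → (∀ i → P i (c i)) × (∀ i → All (_∉ Z) (c i)) ×
    (∀ i i′ → i ≢ i′ → ∀ {v} → v ∈ c i → v ∉ c i′)
choose-disjoint {ℓ = zero}  P L z₀ avoid Z Z≤ = (λ ()) , (λ ()) , (λ ()) , λ ()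
choose-disjoint {n} {ℓ = suc ℓ} P L z₀ avoid Z Z≤ with avoid zero Z (≤-trans (m≤m+n _ _) Z≤)
... | c₀ , P₀ , c₀≤ , c₀∉ with choose-disjoint (λ i → P (suc i)) L z₀ (λ i → avoid (suc i)) (c₀ ++ Z)
        (≤-trans (≤-trans (+-monoˡ-≤ (ℓ * L) (≤-trans (≤-reflexive (length-++ c₀)) (+-monoˡ-≤ (length Z) c₀≤)))
                   (≤-reflexive (budget L (length Z) (ℓ * L)))) Z≤)
  where
  budget : ∀ a z t → a + z + t ≡ z + (a + t)
  budget = solve-∀
...   | c , Pc , c∉ , disj = c′ , P′ , avoids′ , disj′
  where
  c′ : Fin (suc ℓ) → List (Fin n)
  c′ zero    = c₀
  c′ (suc i) = c i
  P′ : ∀ i → P i (c′ i)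
  P′ zero    = P₀
  P′ (suc i) = Pc i
  avoids′ : ∀ i → All (_∉ Z) (c′ i)
  avoids′ zero    = c₀∉
  avoids′ (suc i) = All.map (λ v∉ v∈ → v∉ (∈-++⁺ʳ c₀ v∈)) (c∉ i)
  disj′ : ∀ i i′ → i ≢ i′ → ∀ {v} → v ∈ c′ i → v ∉ c′ i′
  disj′ zero    zero     ne _  _   = ne refl
  disj′ zero    (suc i′) ne v∈ v∈′ = All.lookup (c∉ i′) v∈′ (∈-++⁺ˡ v∈)
  disj′ (suc i) zero     ne v∈ v∈′ = All.lookup (c∉ i) v∈ (∈-++⁺ˡ v∈′)
  disj′ (suc i) (suc i′) ne v∈ v∈′ = disj i i′ (λ eq → ne (cong suc eq)) v∈ v∈′

module Assembly {n : ℕ} (G : Graph n) {ℓ : ℕ} (k : Fin ℓ → ℕ) (i⋆ : Fin ℓ) (L : ℕ) (k≤L : ∀ i → k i ≤ L) where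

  open Paths G
  open Theta G

  -- Two poles, the path `i⋆` with at most `L` interior vertices, and `ℓ` greedy choices of at most
  -- `L` vertices each.
  capacity : ℕ
  capacity = (2 + L) + ℓ * L

  module _ (d₀ X : ℕ) (x : Fin n) (p i₀ H : ℕ) (i₀≤ : i₀ ≤ suc p) (i₀>0 : 0 < i₀) (p>0 : 0 < p)
           (H<d₀ : H * (suc p * (capacity + L)) < d₀) (H<X : H * (suc p * (capacity + L)) < X) where

    open Weights G
    open Walks G d₀ X
    open RichFibres G d₀ X x p i₀ H i₀≤
    open Zigzag G d₀ X x p i₀ H i₀≤ (capacity + L) H<d₀ H<X p>0

    module _ (l : List (Fin n)) (len : length l ≡ j) (ly : Layer (suc L) l) where

      pole : Fin n
      pole = end x (take i₀ l)

      Linked : ℕ → List (Fin n) → Set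
      Linked m c = suc (length c) ≡ m × Path pole c x × Unique c

      x≢pole : x ≢ pole
      x≢pole = subst (λ i → x ≢ end x (take i l)) (m+[n∸m]≡n i₀>0)
        (adm-distinct j len (proj₁ (Layer⇒Bad (suc L) ly)) (i₀ ∸ 1) (≤-trans (≤-reflexive (m+[n∸m]≡n i₀>0)) i₀≤))

      Reachable : ℕ → Set
      Reachable m = ∃ λ t → suc ((j ∸ i₀) + (p + (t + t))) ≡ m

      linked : ∀ i → Reachable (k i) → ∀ Z → length Z ≤ capacity → ∃ λ c → Linked (k i) c × All (_∉ Z) c
      linked i (t , k≡) Z Z≤ =
        let (c , c-len , π , uc , c∉) = link t Z budget l len (layer-mono (s≤s enough) ly)
        in c , (trans (cong suc c-len) k≡ , π , uc) , c∉
        where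
        -- The summand `L` beyond `capacity` is the room for vertices that a single `link` forbids
        -- to itself.
        budget : length Z + ((j ∸ i₀) + (t + t)) ≤ capacity + L
        budget = +-mono-≤ Z≤ (≤-trans (m≤n⇒m≤1+n (+-monoʳ-≤ (j ∸ i₀) (m≤n+m (t + t) p))) (≤-trans (≤-reflexive k≡) (k≤L i)))
        enough : suc (t + t) ≤ L
        enough = ≤-trans (s≤s (≤-trans (m≤n+m (t + t) p) (m≤n+m (p + (t + t)) (j ∸ i₀)))) (≤-trans (≤-reflexive k≡) (k≤L i))

      assemble : (∀ i → i ≢ i⋆ → Reachable (k i)) →
        (∃ λ c → Linked (k i⋆) c × All (_∉ pole ∷ x ∷ []) c) → ContainsTheta ℓ k G
      assemble reach (c⋆ , linked⋆ , c⋆∉) = glue (choose-disjoint P L capacity avoid Z₀ Z₀≤)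
        where
        P : Fin ℓ → List (Fin n) → Set
        P i c = i ≡ i⋆ ⊎ Linked (k i) c

        shorter : ∀ i c → suc (length c) ≡ k i → length c ≤ L
        shorter i c eq = ≤-trans (≤-trans (n≤1+n _) (≤-reflexive eq)) (k≤L i)

        avoid : ∀ i Z → length Z ≤ capacity → ∃ λ c → P i c × length c ≤ L × All (_∉ Z) c
        avoid i Z Z≤ with i ≟ i⋆
        ... | yes eq = [] , inj₁ eq , z≤n , []
        ... | no ne =
          let (c , lk , c∉) = linked i (reach i ne) Z Z≤
          in c , inj₂ lk , shorter i c (proj₁ lk) , c∉

        Z₀ : List (Fin n)
        Z₀ = pole ∷ x ∷ c⋆

        Z₀≤ : length Z₀ + ℓ * L ≤ capacity
        Z₀≤ = +-monoˡ-≤ (ℓ * L) (s≤s (s≤s (shorter i⋆ c⋆ (proj₁ linked⋆))))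

        glue : (∃ λ (c : Fin ℓ → List (Fin n)) → (∀ i → P i (c i)) × (∀ i → All (_∉ Z₀) (c i)) ×
                 (∀ i i′ → i ≢ i′ → ∀ {v} → v ∈ c i → v ∉ c i′)) → ContainsTheta ℓ k G
        glue (c , Pc , c∉ , disj) = paths⇒theta k pole x (λ eq → x≢pole (sym eq)) c′
            (λ i → proj₁ (lk i)) (λ i → proj₁ (proj₂ (lk i))) (λ i → proj₂ (proj₂ (lk i)))
            (λ i p∈ → All.lookup (poles∉ i) p∈ (here refl)) (λ i x∈ → All.lookup (poles∉ i) x∈ (there (here refl))) disj′
          where
          c′ : Fin ℓ → List (Fin n)
          c′ i with i ≟ i⋆
          ... | yes _ = c⋆
          ... | no _  = c i

          lk : ∀ i → Linked (k i) (c′ i)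
          lk i with i ≟ i⋆ | Pc i
          ... | yes refl | _       = linked⋆
          ... | no ne    | inj₁ eq = ⊥-elim (ne eq)
          ... | no _     | inj₂ q  = q

          poles∉ : ∀ i → All (_∉ pole ∷ x ∷ []) (c′ i)
          poles∉ i with i ≟ i⋆
          ... | yes _ = c⋆∉
          ... | no _  = All.map (λ v∉ v∈ → v∉ (∈-++⁺ˡ v∈)) (c∉ i)

          disj′ : ∀ i i′ → i ≢ i′ → ∀ {v} → v ∈ c′ i → v ∉ c′ i′
          disj′ i i′ ne v∈ v∈′ with i ≟ i⋆ | i′ ≟ i⋆
          ... | yes e | yes e′ = ne (trans e (sym e′))
          ... | yes _ | no _   = All.lookup (c∉ i′) v∈′ (there (there v∈))
          ... | no _  | yes _  = All.lookup (c∉ i) v∈ (there (there v∈′))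
          ... | no _  | no _   = disj i i′ ne v∈ v∈′

      -- The segment is reversed because the theta graph is built from `pole` to `x`.
      initial-segment : ∀ a → k i⋆ ≡ suc a → i₀ ≡ suc a → ∃ λ c → Linked (k i⋆) c × All (_∉ pole ∷ x ∷ []) c
      initial-segment a k≡ refl = reverse c ,
          (trans (cong suc (trans (length-reverse c) (length-take-≤ {l = pre} pre-len (n≤1+n a)))) (sym k≡) ,
           path-reverse c (walk⇒path a pre pre-len (walk-take i₀ l (layer-walk (suc L) len ly))) ,
           unique-reverse (proj₁ pre-unique)) ,
          all-reverse (All.tabulate (λ v∈ → λ { (here refl) → proj₂ pre-unique v∈ ; (there (here refl)) → x∉pre (∈-take v∈) }))
        where
        pre c : List (Fin n)
        pre = take i₀ l
        c   = take a pre
        pre-len : length pre ≡ i₀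
        pre-len = length-take-≤ {l = l} len i₀≤
        whole : Unique (x ∷ l)
        whole = layer-unique (suc L) len ly
        pre-unique : Unique c × pole ∉ c
        pre-unique = unique-∷ʳ⁻ c (subst Unique (sym (take-end a x pre pre-len)) (proj₂ (unique-uncons (take⁺ (suc i₀) whole))))
          where
          unique-uncons : ∀ {v l} → Unique (v ∷ l) → All (v ≢_) l × Unique {A = Fin n} l
          unique-uncons (v∉ ∷ u) = v∉ , u
        x∉pre : x ∉ pre
        x∉pre x∈ with take⁺ (suc i₀) whole
        ... | x∉ ∷ _ = All.lookup x∉ x∈ refl
        ∈-take : ∀ {v} → v ∈ c → v ∈ pre
        ∈-take v∈ = subst (_ ∈_) (take++drop≡id a pre) (∈-++⁺ˡ v∈)

    layer⇒theta : (∃ λ l → length l ≡ j × Layer (suc L) l) → (∀ i → i ≢ i⋆ → ∃ λ t → suc ((j ∸ i₀) + (p + (t + t))) ≡ k i) →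
      (k i⋆ ≡ i₀ ⊎ ∃ λ t → suc ((j ∸ i₀) + (p + (t + t))) ≡ k i⋆) → ContainsTheta ℓ k G
    layer⇒theta (l , len , ly) reach (inj₁ eq) =
      assemble l len ly reach (initial-segment l len ly (i₀ ∸ 1) (trans eq (sym (m+[n∸m]≡n i₀>0))) (sym (m+[n∸m]≡n i₀>0)))
    layer⇒theta (l , len , ly) reach (inj₂ r) =
      assemble l len ly reach (linked l len ly i⋆ r (pole l len ly ∷ x ∷ []) (≤-trans (m≤m+n 2 L) (m≤m+n (2 + L) (ℓ * L))))

-- Parity and the lengths of the paths.

halve : ∀ e → (∃ λ t → e ≡ t + t) ⊎ (∃ λ t → e ≡ suc (t + t))
halve zero = inj₁ (0 , refl)
halve (suc e) with halve e
... | inj₁ (t , refl) = inj₂ (t , refl)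
... | inj₂ (t , refl) = inj₁ (suc t , cong suc (sym (+-suc t t)))

suc-%2 : ∀ m → suc m % 2 ≢ m % 2
suc-%2 zero          ()
suc-%2 (suc zero)    ()
suc-%2 (suc (suc m)) eq = suc-%2 m eq

even-gap : ∀ {m k} → m ≤ k → m % 2 ≡ k % 2 → ∃ λ h → k ≡ m + (h + h)
even-gap {m} {k} m≤k par with m≤n⇒∃[o]m+o≡n m≤k
... | e , refl with halve e
...   | inj₁ (t , refl) = t , refl
...   | inj₂ (t , refl) = ⊥-elim (suc-%2 m (trans (sym ([m+kn]%n≡m%n (suc m) t 2)) (trans (cong (_% 2) (rearrange m t)) (sym par))))
  where
  rearrange : ∀ m t → 1 + m + t * 2 ≡ m + (1 + (t + t))
  rearrange = solve-∀

-- The shortest path of the theta graph has length a. If a < j, it is an initial segment of a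
-- walk of length j; otherwise every path, this one included, starts near the end of such a walk.
path-lengths : ∀ {ℓ} (k : Fin ℓ → ℕ) (i⋆ : Fin ℓ) (h : Fin ℓ → ℕ) → 0 < k i⋆ → (∀ i → k i ≡ k i⋆ + (h i + h i)) →
  ∀ p → 0 < p → (∀ i → i ≢ i⋆ → suc p ≤ k i⋆ + h i) →
  ∃ λ i₀ → i₀ ≤ suc p × 0 < i₀ ×
    (∀ i → i ≢ i⋆ → ∃ λ t → suc ((suc p ∸ i₀) + (p + (t + t))) ≡ k i) ×
    (k i⋆ ≡ i₀ ⊎ ∃ λ t → suc ((suc p ∸ i₀) + (p + (t + t))) ≡ k i⋆)
path-lengths k i⋆ h a>0 k≡ p p>0 j≤ with <-≤-connex (k i⋆) (suc p)
... | inj₁ a<j = k i⋆ , <⇒≤ a<j , a>0 , reach , inj₁ refl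
  where
  a δ : ℕ
  a = k i⋆
  δ = suc p ∸ a
  j≡ : a + δ ≡ suc p
  j≡ = m+[n∸m]≡n (<⇒≤ a<j)
  rearrange : ∀ a d t → d + (a + d) + (t + t) ≡ a + ((d + t) + (d + t))
  rearrange = solve-∀
  reach : ∀ i → i ≢ i⋆ → ∃ λ t → suc (δ + (p + (t + t))) ≡ k i
  reach i ne with m≤n⇒∃[o]m+o≡n (+-cancelˡ-≤ a δ (h i) (≤-trans (≤-reflexive j≡) (j≤ i ne)))
  ... | t , δ+t≡h = t , (begin
    suc (δ + (p + (t + t)))      ≡⟨ sym (+-suc δ (p + (t + t))) ⟩
    δ + (suc p + (t + t))        ≡⟨ sym (+-assoc δ (suc p) (t + t)) ⟩
    δ + suc p + (t + t)          ≡⟨ cong (λ j → δ + j + (t + t)) (sym j≡) ⟩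
    δ + (a + δ) + (t + t)        ≡⟨ rearrange a δ t ⟩
    a + ((δ + t) + (δ + t))      ≡⟨ cong (λ h → a + (h + h)) δ+t≡h ⟩
    a + (h i + h i)              ≡⟨ sym (k≡ i) ⟩
    k i                          ∎)
    where open ≡-Reasoning
... | inj₂ j≤a with m≤n⇒∃[o]m+o≡n j≤a
...   | e , j+e≡a with halve e
...     | inj₁ (t₀ , refl) = suc p , ≤-refl , s≤s z≤n , (λ i _ → reach i) , inj₂ (reach i⋆)
  where
  rearrange : ∀ j t h → j + ((t + h) + (t + h)) ≡ j + (t + t) + (h + h)
  rearrange = solve-∀
  reach : ∀ i → ∃ λ t → suc ((p ∸ p) + (p + (t + t))) ≡ k i
  reach i = t₀ + h i , trans (cong (λ m → suc (m + (p + ((t₀ + h i) + (t₀ + h i))))) (n∸n≡0 p))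
    (trans (rearrange (suc p) t₀ (h i)) (trans (cong (_+ (h i + h i)) j+e≡a) (sym (k≡ i))))
...     | inj₂ (t₀ , refl) = p , n≤1+n p , p>0 , (λ i _ → reach i) , inj₂ (reach i⋆)
  where
  rearrange : ∀ p t h → 1 + (1 + (p + ((t + h) + (t + h)))) ≡ 1 + p + (1 + (t + t)) + (h + h)
  rearrange = solve-∀
  reach : ∀ i → ∃ λ t → suc ((suc p ∸ p) + (p + (t + t))) ≡ k i
  reach i = t₀ + h i , trans (cong (λ m → suc (m + (p + ((t₀ + h i) + (t₀ + h i))))) (m+n∸n≡m 1 p))
    (trans (rearrange p t₀ (h i)) (trans (cong (_+ (h i + h i)) j+e≡a) (sym (k≡ i))))

-- Constants and the final bound.

module ShortWalks {n : ℕ} (G : Graph n) (d₀ X : ℕ) (X>0 : 0 < X) where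

  open Weights G
  open Walks G d₀ X

  -- At most one walk of length 1 joins two given vertices, so `v ∷ []` carries all of `W 1 x v`.
  good₁ : ∀ x v → Good x (v ∷ [])
  good₁ x v = begin
    W 1 x v
      ≡⟨ ∑-words-suc 0 (λ l → # (end x l ≟ v) * u x l) ⟩
    ∑ (allFin n) (λ w → # (w ≟ v) * u x (w ∷ []) + 0)
      ≤⟨ ∑-mono (allFin n) (λ {w} _ → single w) ⟩
    ∑ (allFin n) (λ w → # (v ≟ w) * u x (v ∷ []))
      ≡⟨ ∑-*ʳ (u x (v ∷ [])) (allFin n) (λ w → # (v ≟ w)) ⟩
    ∑ (allFin n) (λ w → # (v ≟ w)) * u x (v ∷ [])
      ≤⟨ *-monoˡ-≤ (u x (v ∷ [])) (≤-trans (∑-≟≤1 v) (≤-trans X>0 (≤-reflexive (sym (*-identityʳ X))))) ⟩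
    X ^ 1 * u x (v ∷ []) ∎
    where
    open ≤-Reasoning
    single : ∀ w → # (w ≟ v) * u x (w ∷ []) + 0 ≤ # (v ≟ w) * u x (v ∷ [])
    single w with w ≟ v
    ... | no _     = z≤n
    ... | yes refl = ≤-reflexive (trans (+-identityʳ _) (cong (_* u x (w ∷ [])) (sym (#-yes (w ≟ w) refl))))

  -- Walks of length at most 1 are good, so the sum is 0. The exchange argument can therefore start
  -- at `j = 2`, where walks have interior vertices.
  no-short-bad : ∀ j x → j ≤ 1 → ∀ E → E * ∑ (words j) (λ l → u x l * # (Bad? j x l)) ≤ M ^ j
  no-short-bad j x j≤1 E = ≤-trans (≤-reflexive (trans (cong (E *_) (∑-zero (words j) (λ {l} l∈ →
      trans (cong (u x l *_) (#-no (Bad? j x l) (λ (_ , ¬good) → ¬good (good l (subst (_≤ 1) (sym (∈-words j l∈)) j≤1)))))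
            (*-zeroʳ (u x l))))) (*-zeroʳ E))) z≤n
    where
    good : ∀ l → length l ≤ 1 → Good x l
    good []          _         = good₀ x
    good (v ∷ [])    _         = good₁ x v
    good (_ ∷ _ ∷ _) (s≤s ())

module ThetaFree {ℓ : ℕ} (k : Fin ℓ → ℕ) (i⋆ : Fin ℓ) (h : Fin ℓ → ℕ) (k⋆>0 : 0 < k i⋆)
                 (k≡ : ∀ i → k i ≡ k i⋆ + (h i + h i)) (s-1 : ℕ) (s≤ : ∀ i → i ≢ i⋆ → suc s-1 ≤ k i⋆ + h i) where

  -- `L` bounds all path lengths and thereby the number of layers; `E` is the factor of
  -- `degree-sum-bound`; `H` is that of `layer-inhabited` for `r = L`; `Y` bounds `H * (j * z₀)` for
  -- all `j ≤ s`. `C₁` serves the dense case, `C₂` the sparse one.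
  s L E H Y X C₁ C₂ C : ℕ
  s = suc s-1
  L = ∑ (allFin ℓ) k
  E = 2 * rate s
  H = suc L * 3 * E
  Y = H * (s * (((2 + L) + ℓ * L) + L))
  X = suc Y
  C₁ = (2 * E) ^ s-1 * (2 * X ^ suc (2 * s-1))
  C₂ = (E * suc (Y + E)) ^ s
  C = C₁ + C₂

  E>0 : 0 < E
  E>0 = *-mono-< {0} {2} {0} (s≤s z≤n) (rate>0 s)

  k≤L : ∀ i → k i ≤ L
  k≤L i = ∈⇒≤∑ k (∈-allFin i)

  module _ {n : ℕ} (G : Graph n) (free : ¬ ContainsTheta ℓ k G) where

    open Weights G

    module _ (d₀ : ℕ) (Y<d₀ : Y < d₀) where

      open Walks G d₀ X

      -- If it failed for some `j` and `x`, `layer-inhabited` would supply a walk in the deepest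
      -- layer, and `layer⇒theta` a theta graph, against `free`.
      few-bad : ∀ j x → j ≤ s → E * ∑ (words j) (λ l → u x l * # (Bad? j x l)) ≤ M ^ j
      few-bad zero          x _ = ShortWalks.no-short-bad G d₀ X (s≤s z≤n) 0 x z≤n E
      few-bad (suc zero)    x _ = ShortWalks.no-short-bad G d₀ X (s≤s z≤n) 1 x ≤-refl E
      few-bad (suc (suc p)) x j≤s
        with E * ∑ (words (suc (suc p))) (λ l → u x l * # (Bad? (suc (suc p)) x l)) ≤? M ^ suc (suc p)
      ... | yes few = few
      ... | no many with path-lengths k i⋆ h k⋆>0 k≡ (suc p) (s≤s z≤n) (λ i ne → ≤-trans j≤s (s≤ i ne))
      ...   | i₀ , i₀≤ , i₀>0 , reach , reach⋆ = ⊥-elim (free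
              (Assembly.layer⇒theta G k i⋆ L k≤L d₀ X x (suc p) i₀ H i₀≤ i₀>0 (s≤s z≤n) (≤-trans (s≤s small) Y<d₀) (s≤s small)
                (RichFibres.layer-inhabited G d₀ X x (suc p) i₀ H i₀≤ L E refl (≰⇒> many)) reach reach⋆))
        where
        small : H * (suc (suc p) * (((2 + L) + ℓ * L) + L)) ≤ Y
        small = *-monoʳ-≤ H (*-monoˡ-≤ (((2 + L) + ℓ * L) + L) j≤s)

    edgeCount≤B : edgeCount G ≤ B
    edgeCount≤B = ∑-mono (allFin n) (λ {v} _ → ∑-mono (allFin n) (λ {w} _ → ordered (toℕ v <ᵇ toℕ w) v w))
      where
      ordered : ∀ b v w → (if b ∧ adj G v w then 1 else 0) ≤ A v w
      ordered true  v w = ≤-refl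
      ordered false v w = z≤n

    -- With `d₀` the rounded quotient of `B` by `E * n`, vertices of degree below `d₀` carry at most
    -- `1 / E` of the degree sum. If `d₀` is at most the constant `Y + E`, then `B` is linear in
    -- `n`; otherwise `degree-sum-bound` applies.
    B-bound : 1 ≤ n → B ^ s ≤ C * n ^ (s + 1)
    B-bound n>0 = ≤-trans (by-density (<-≤-connex (Y + E) d₀)) (≤-reflexive (cong (λ m → C * n ^ m) (+-comm 1 s)))
      where
      open ≤-Reasoning
      instance
        En≢0 : NonZero (E * n)
        En≢0 = >-nonZero (*-mono-< {0} {E} {0} E>0 n>0)
      d₀ : ℕ
      d₀ = B / (E * n)
      B< : B ≤ E * n * suc d₀
      B< = begin
        B                                 ≡⟨ m≡m%n+[m/n]*n B (E * n) ⟩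
        B % (E * n) + d₀ * (E * n)        ≤⟨ +-monoˡ-≤ (d₀ * (E * n)) (<⇒≤ (m%n<n B (E * n))) ⟩
        E * n + d₀ * (E * n)              ≡⟨ *-comm (suc d₀) (E * n) ⟩
        E * n * suc d₀                    ∎
      by-density : Y + E < d₀ ⊎ d₀ ≤ Y + E → B ^ s ≤ C * n ^ suc s
      by-density (inj₁ big) = begin
        -- One factor `B` is kept for `degree-sum-bound`; the others are replaced by
        -- `2 * E * n * d₀`, using `suc d₀ ≤ d₀ + d₀`.
        B * B ^ s-1
          ≤⟨ *-monoʳ-≤ B (^-monoˡ-≤ s-1 (≤-trans B< (*-monoʳ-≤ (E * n) (+-monoˡ-≤ d₀ (≤-trans (s≤s z≤n) big))))) ⟩
        B * (E * n * (d₀ + d₀)) ^ s-1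
          ≡⟨ cong (B *_) (trans (cong (_^ s-1) (rearrange₁ E n d₀)) (trans (^-distribʳ-* (2 * E * n) d₀ s-1) (cong (_* d₀ ^ s-1) (^-distribʳ-* (2 * E) n s-1)))) ⟩
        B * ((2 * E) ^ s-1 * n ^ s-1 * d₀ ^ s-1)
          ≡⟨ rearrange₂ B ((2 * E) ^ s-1) (n ^ s-1) (d₀ ^ s-1) ⟩
        (2 * E) ^ s-1 * n ^ s-1 * (d₀ ^ s-1 * B)
          ≤⟨ *-monoʳ-≤ ((2 * E) ^ s-1 * n ^ s-1) (Density.degree-sum-bound G d₀ X s-1
               (<⇒≤ (≤-trans (s≤s (m≤n+m E Y)) big))
               (≤-trans (≤-reflexive (rearrange₃ E n d₀)) (m/n*n≤m B (E * n)))
               (few-bad d₀ (≤-trans (s≤s (m≤m+n Y E)) big))) ⟩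
        (2 * E) ^ s-1 * n ^ s-1 * (2 * (n * (n * X ^ suc (2 * s-1))))
          ≡⟨ rearrange₄ ((2 * E) ^ s-1) (n ^ s-1) n (X ^ suc (2 * s-1)) ⟩
        C₁ * n ^ suc s
          ≤⟨ *-monoˡ-≤ (n ^ suc s) (m≤m+n C₁ C₂) ⟩
        C * n ^ suc s ∎
        where
        rearrange₁ : ∀ e n d → e * n * (d + d) ≡ 2 * e * n * d
        rearrange₁ = solve-∀
        rearrange₂ : ∀ b x y z → b * (x * y * z) ≡ x * y * (z * b)
        rearrange₂ = solve-∀
        rearrange₃ : ∀ e n d → e * (n * d) ≡ d * (e * n)
        rearrange₃ = solve-∀
        rearrange₄ : ∀ x y n z → x * y * (2 * (n * (n * z))) ≡ x * (2 * z) * (n * (n * y))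
        rearrange₄ = solve-∀
      by-density (inj₂ small) = begin
        B ^ s                              ≤⟨ ^-monoˡ-≤ s (≤-trans B< (*-monoʳ-≤ (E * n) (s≤s small))) ⟩
        (E * n * suc (Y + E)) ^ s          ≡⟨ cong (_^ s) (rearrange E n (suc (Y + E))) ⟩
        (E * suc (Y + E) * n) ^ s          ≡⟨ ^-distribʳ-* (E * suc (Y + E)) n s ⟩
        C₂ * n ^ s                         ≤⟨ *-mono-≤ (m≤n+m C₂ C₁) (^-monoʳ-≤ n {{>-nonZero n>0}} (n≤1+n s)) ⟩
        C * n ^ suc s              ∎
        where
        rearrange : ∀ e n y → e * n * y ≡ e * y * n
        rearrange = solve-∀

  edge-bound : ∀ n → 1 ≤ n → (G : Graph n) → ¬ ContainsTheta ℓ k G → edgeCount G ^ s ≤ C * n ^ (s + 1)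
  edge-bound n n>0 G free = ≤-trans (^-monoˡ-≤ s (edgeCount≤B G free)) (B-bound G free n>0)

-- The pair `i`, `j` attains the least sum and `k i ≤ k j`, so replacing `j` by any other index
-- shows that `k i` is the least length. The other lengths exceed it by even amounts, and
-- `2 * s ≤ k i + k i′` can be halved.
edges-of-theta-free : ∀ {ℓ} (k : Fin ℓ → ℕ) → (∀ i → 1 ≤ k i) → (∀ i j → k i % 2 ≡ k j % 2) →
  ∀ s i j → i ≢ j → k i ≤ k j → k i + k j ≡ 2 * s → (∀ i j → i ≢ j → 2 * s ≤ k i + k j) →
  ∃ λ C → ∀ n → 1 ≤ n → (G : Graph n) → ¬ ContainsTheta ℓ k G → edgeCount G ^ s ≤ C * n ^ (s + 1)
edges-of-theta-free k k>0 parity zero i j i≢j ki≤kj sum≡ minimal =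
  ⊥-elim (n≮0 (≤-trans (k>0 i) (≤-trans (m≤m+n (k i) (k j)) (≤-reflexive sum≡))))
edges-of-theta-free {ℓ} k k>0 parity (suc s-1) i j i≢j ki≤kj sum≡ minimal =
  ThetaFree.C k i h (k>0 i) k≡ s-1 s≤ , ThetaFree.edge-bound k i h (k>0 i) k≡ s-1 s≤
  where
  shortest : ∀ i′ → k i ≤ k i′
  shortest i′ with i′ ≟ i
  ... | yes refl = ≤-refl
  ... | no ne    = ≤-trans ki≤kj (+-cancelˡ-≤ (k i) (k j) (k i′)
                     (≤-trans (≤-reflexive sum≡) (minimal i i′ (λ eq → ne (sym eq)))))
  h : Fin ℓ → ℕ
  h i′ = proj₁ (even-gap (shortest i′) (parity i i′))
  k≡ : ∀ i′ → k i′ ≡ k i + (h i′ + h i′)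
  k≡ i′ = proj₂ (even-gap (shortest i′) (parity i i′))
  rearrange : ∀ a h → a + (a + (h + h)) ≡ 2 * (a + h)
  rearrange = solve-∀
  s≤ : ∀ i′ → i′ ≢ i → suc s-1 ≤ k i + h i′
  s≤ i′ ne = *-cancelˡ-≤ 2 (≤-trans (minimal i i′ (λ eq → ne (sym eq)))
    (≤-reflexive (trans (cong (k i +_) (k≡ i′)) (rearrange (k i) (h i′)))))

theorem1p1 : (ℓ : ℕ) → 2 ≤ ℓ → (k : Fin ℓ → ℕ) →
    (∀ i → 1 ≤ k i) →
    (∀ i j → k i % 2 ≡ k j % 2) →
    (∀ i j → k i ≡ 1 → k j ≡ 1 → i ≡ j) →
    (s : ℕ) → IsKStar k s →
    Σ ℕ λ C → Σ ℕ λ n₀ → ∀ (n : ℕ) → n₀ ≤ n → (G : Graph n) →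
    ¬ ContainsTheta ℓ k G →
    edgeCount G ^ s ≤ C * n ^ (s + 1)
theorem1p1 ℓ _ k k>0 parity _ s ((i , j , i≢j , sum≡) , minimal) with ≤-total (k i) (k j)
-- The attaining pair is ordered with its shorter path first. The threshold `n₀ = 1` makes `E * n` a
-- valid divisor.
... | inj₁ ki≤kj =
  let (C , bound) = edges-of-theta-free k k>0 parity s i j i≢j ki≤kj sum≡ minimal in C , 1 , bound
... | inj₂ kj≤ki =
  let (C , bound) = edges-of-theta-free k k>0 parity s j i (λ eq → i≢j (sym eq)) kj≤ki (trans (+-comm (k j) (k i)) sum≡) minimal
  in C , 1 , bound
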